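{- For every integer $d\ge5$, there exists an ellipsoid $E\subset\mathbb R^d$ such that the lattice polytope $P(E)=\operatorname{conv}\big(\operatorname{conv}(E)\cap\mathbb Z^d\big)$, i.e., the convex hull of the lattice points in the solid ellipsoid bounded by $E$, is not normal.
   Context: A polytope $P\subset\mathbb R^d$ is normal if it is a lattice polytope (all vertices in $\mathbb Z^d$) and for every natural number $c$ and every $x\in(cP)\cap\mathbb Z^d$ there exist $x_1,\ldots,x_c\in P\cap\mathbb Z^d$ with $x_1+\cdots+x_c=x$. (No condition is imposed on the subgroup of $\mathbb Z^d$ generated by differences of lattice points of $P$.) An ellipsoid $E\subset\mathbb R^d$ is a set of the form $\{x\in\mathbb R^d \mid (l_1(x)-a_1)^2+\cdots+(l_d(x)-a_d)^2=1\}$, where $l_1,\ldots,l_d$ is a full-rank system of real linear forms on $\mathbb R^d$ and $a_1,\ldots,a_d\in\mathbb R$. -}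

module Defs where

open import Algebra.Bundles.Raw using (RawMonoid)
import Algebra.Definitions.RawMonoid as RawMonoidDefs
open import Data.Integer.Base using (ℤ; +_)
open import Data.Nat.Base as ℕ using (ℕ)
import Data.Nat.Properties as ℕₚ
open import Data.Product.Base using (∃; ∃-syntax; _×_; _,_)
open import Data.Rational.Base as ℚ using (ℚ; 0ℚ; 1ℚ; ½; ∣_∣)
import Data.Rational.Properties as ℚₚ
open import Data.Rational.Solver using (module +-*-Solver)
open import Data.Vec.Functional using (Vector; map; zipWith)
open import Data.Vec.Functional.Relation.Binary.Pointwise using (Pointwise)
open import Level using (0ℓ)
open import Relation.Binary.Core using (Rel)
open import Relation.Binary.PropositionalEquality
  using (_≡_; refl; sym; cong; cong₂; subst)
open import Relation.Unary using (Pred; _∈_; _∩_; _≐_)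

-- ℝ is the setoid of Cauchy sequences of rationals modulo null sequences (_≈_).

IsCauchy : Pred (ℕ → ℚ) 0ℓ
IsCauchy s = ∀ ε → 0ℚ ℚ.< ε →
  ∃[ N ] (∀ m n → N ℕ.≤ m → N ℕ.≤ n → ∣ s m ℚ.- s n ∣ ℚ.< ε)

record ℝ : Set where
  constructor mkℝ
  field
    seq    : ℕ → ℚ
    cauchy : IsCauchy seq

open ℝ public

halves : ∀ ε → ½ ℚ.* ε ℚ.+ ½ ℚ.* ε ≡ ε
halves ε = solve 1 (λ e → con ½ :* e :+ con ½ :* e := e) refl ε
  where open +-*-Solver

half-pos : ∀ {ε} → 0ℚ ℚ.< ε → 0ℚ ℚ.< ½ ℚ.* ε
half-pos 0<ε = ℚₚ.*-monoʳ-<-pos ½ 0<ε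

const-cauchy : ∀ q → IsCauchy (λ _ → q)
const-cauchy q ε 0<ε = 0 , λ _ _ _ _ →
  subst (λ r → ∣ r ∣ ℚ.< ε) (sym (ℚₚ.+-inverseʳ q)) 0<ε

+-cauchy : ∀ s t → IsCauchy s → IsCauchy t → IsCauchy (λ n → s n ℚ.+ t n)
+-cauchy s t cs ct ε 0<ε with cs (½ ℚ.* ε) (half-pos 0<ε) | ct (½ ℚ.* ε) (half-pos 0<ε)
... | M , hs | N , ht = M ℕ.⊔ N , λ m n p q → begin-strict
  ∣ (s m ℚ.+ t m) ℚ.- (s n ℚ.+ t n) ∣    ≡⟨ cong ∣_∣ (rearrange (s m) (t m) (s n) (t n)) ⟩
  ∣ (s m ℚ.- s n) ℚ.+ (t m ℚ.- t n) ∣    ≤⟨ ℚₚ.∣p+q∣≤∣p∣+∣q∣ (s m ℚ.- s n) (t m ℚ.- t n) ⟩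
  ∣ s m ℚ.- s n ∣ ℚ.+ ∣ t m ℚ.- t n ∣    <⟨ ℚₚ.+-mono-<
                                              (hs m n (ℕₚ.m⊔n≤o⇒m≤o M N p) (ℕₚ.m⊔n≤o⇒m≤o M N q))
                                              (ht m n (ℕₚ.m⊔n≤o⇒n≤o M N p) (ℕₚ.m⊔n≤o⇒n≤o M N q)) ⟩
  ½ ℚ.* ε ℚ.+ ½ ℚ.* ε                    ≡⟨ halves ε ⟩
  ε                                      ∎
  where
  open ℚₚ.≤-Reasoning
  rearrange : ∀ a b c d → (a ℚ.+ b) ℚ.- (c ℚ.+ d) ≡ (a ℚ.- c) ℚ.+ (b ℚ.- d)
  rearrange = solve 4 (λ a b c d → (a :+ b) :- (c :+ d) := (a :- c) :+ (b :- d)) refl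
    where open +-*-Solver

neg-cauchy : ∀ s → IsCauchy s → IsCauchy (λ n → ℚ.- s n)
neg-cauchy s cs ε 0<ε with cs ε 0<ε
... | N , hs = N , λ m n p q → begin-strict
  ∣ (ℚ.- s m) ℚ.- (ℚ.- s n) ∣    ≡⟨ cong ∣_∣ (sym (ℚₚ.neg-distrib-+ (s m) (ℚ.- s n))) ⟩
  ∣ ℚ.- (s m ℚ.- s n) ∣          ≡⟨ ℚₚ.∣-p∣≡∣p∣ (s m ℚ.- s n) ⟩
  ∣ s m ℚ.- s n ∣                <⟨ hs m n p q ⟩
  ε                              ∎
  where open ℚₚ.≤-Reasoning

bounded : ∀ s → IsCauchy s →
          ∃[ B ] 0ℚ ℚ.< B × ∃[ N ] (∀ n → N ℕ.≤ n → ∣ s n ∣ ℚ.< B)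
bounded s cs with cs 1ℚ (ℚₚ.positive⁻¹ 1ℚ)
... | N , hs = ∣ s N ∣ ℚ.+ 1ℚ
             , ℚₚ.+-mono-≤-< (ℚₚ.0≤∣p∣ (s N)) (ℚₚ.positive⁻¹ 1ℚ)
             , N , λ n p → begin-strict
  ∣ s n ∣                          ≡⟨ cong ∣_∣ (split (s n) (s N)) ⟩
  ∣ s N ℚ.+ (s n ℚ.- s N) ∣        ≤⟨ ℚₚ.∣p+q∣≤∣p∣+∣q∣ (s N) (s n ℚ.- s N) ⟩
  ∣ s N ∣ ℚ.+ ∣ s n ℚ.- s N ∣      <⟨ ℚₚ.+-monoʳ-< ∣ s N ∣ (hs n N p ℕₚ.≤-refl) ⟩
  ∣ s N ∣ ℚ.+ 1ℚ                   ∎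
  where
  open ℚₚ.≤-Reasoning
  split : ∀ a b → a ≡ b ℚ.+ (a ℚ.- b)
  split = solve 2 (λ a b → a := b :+ (a :- b)) refl
    where open +-*-Solver

∣*∣-mono-< : ∀ {a b B δ} → 0ℚ ℚ.< B → ∣ a ∣ ℚ.< B → ∣ b ∣ ℚ.< δ → ∣ a ℚ.* b ∣ ℚ.< B ℚ.* δ
∣*∣-mono-< {a} {b} {B} {δ} 0<B a<B b<δ = begin-strict
  ∣ a ℚ.* b ∣        ≡⟨ ℚₚ.∣p*q∣≡∣p∣*∣q∣ a b ⟩
  ∣ a ∣ ℚ.* ∣ b ∣    ≤⟨ ℚₚ.*-monoʳ-≤-nonNeg ∣ b ∣ {{ℚₚ.∣-∣-nonNeg b}} (ℚₚ.<⇒≤ a<B) ⟩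
  B ℚ.* ∣ b ∣        <⟨ ℚₚ.*-monoʳ-<-pos B {{ℚ.positive 0<B}} b<δ ⟩
  B ℚ.* δ            ∎
  where open ℚₚ.≤-Reasoning

*-rearrange : ∀ a b c d →
  a ℚ.* b ℚ.- c ℚ.* d ≡ a ℚ.* (b ℚ.- d) ℚ.+ d ℚ.* (a ℚ.- c)
*-rearrange = solve 4 (λ a b c d → a :* b :- c :* d := a :* (b :- d) :+ d :* (a :- c)) refl
  where open +-*-Solver

divide : ∀ {B ε} → 0ℚ ℚ.< B → 0ℚ ℚ.< ε → ∃[ δ ] 0ℚ ℚ.< δ × B ℚ.* δ ≡ ε
divide {B} {ε} 0<B 0<ε = ℚ.1/ B ℚ.* ε , 0<δ , Bδ≡ε
  where
  instance
    B-pos   = ℚ.positive 0<B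
    ε-pos   = ℚ.positive 0<ε
    B-nz    = ℚₚ.pos⇒nonZero B
    1/B-pos = ℚₚ.1/pos⇒pos B

  0<δ : 0ℚ ℚ.< ℚ.1/ B ℚ.* ε
  0<δ = ℚₚ.positive⁻¹ (ℚ.1/ B ℚ.* ε) {{ℚₚ.pos*pos⇒pos (ℚ.1/ B) ε}}

  Bδ≡ε : B ℚ.* (ℚ.1/ B ℚ.* ε) ≡ ε
  Bδ≡ε = begin-equality
    B ℚ.* (ℚ.1/ B ℚ.* ε)   ≡⟨ sym (ℚₚ.*-assoc B (ℚ.1/ B) ε) ⟩
    (B ℚ.* ℚ.1/ B) ℚ.* ε   ≡⟨ cong (ℚ._* ε) (ℚₚ.*-inverseʳ B) ⟩
    1ℚ ℚ.* ε               ≡⟨ ℚₚ.*-identityˡ ε ⟩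
    ε                      ∎
    where open ℚₚ.≤-Reasoning

*-cauchy : ∀ s t → IsCauchy s → IsCauchy t → IsCauchy (λ n → s n ℚ.* t n)
*-cauchy s t cs ct ε 0<ε =
  let S , 0<S , K , s<S = bounded s cs
      T , 0<T , L , t<T = bounded t ct
      δ , 0<δ , Sδ≡½ε   = divide 0<S (half-pos 0<ε)
      η , 0<η , Tη≡½ε   = divide 0<T (half-pos 0<ε)
      M , hs            = cs η 0<η
      N , ht            = ct δ 0<δ
  in (K ℕ.⊔ L) ℕ.⊔ (M ℕ.⊔ N) , λ m n p q →
  let KL≤m = ℕₚ.m⊔n≤o⇒m≤o (K ℕ.⊔ L) (M ℕ.⊔ N) p
      KL≤n = ℕₚ.m⊔n≤o⇒m≤o (K ℕ.⊔ L) (M ℕ.⊔ N) q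
      MN≤m = ℕₚ.m⊔n≤o⇒n≤o (K ℕ.⊔ L) (M ℕ.⊔ N) p
      MN≤n = ℕₚ.m⊔n≤o⇒n≤o (K ℕ.⊔ L) (M ℕ.⊔ N) q
  in begin-strict
  ∣ s m ℚ.* t m ℚ.- s n ℚ.* t n ∣
    ≡⟨ cong ∣_∣ (*-rearrange (s m) (t m) (s n) (t n)) ⟩
  ∣ s m ℚ.* (t m ℚ.- t n) ℚ.+ t n ℚ.* (s m ℚ.- s n) ∣
    ≤⟨ ℚₚ.∣p+q∣≤∣p∣+∣q∣ (s m ℚ.* (t m ℚ.- t n)) (t n ℚ.* (s m ℚ.- s n)) ⟩
  ∣ s m ℚ.* (t m ℚ.- t n) ∣ ℚ.+ ∣ t n ℚ.* (s m ℚ.- s n) ∣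
    <⟨ ℚₚ.+-mono-<
         (∣*∣-mono-< {s m} 0<S (s<S m (ℕₚ.m⊔n≤o⇒m≤o K L KL≤m))
           (ht m n (ℕₚ.m⊔n≤o⇒n≤o M N MN≤m) (ℕₚ.m⊔n≤o⇒n≤o M N MN≤n)))
         (∣*∣-mono-< {t n} 0<T (t<T n (ℕₚ.m⊔n≤o⇒n≤o K L KL≤n))
           (hs m n (ℕₚ.m⊔n≤o⇒m≤o M N MN≤m) (ℕₚ.m⊔n≤o⇒m≤o M N MN≤n))) ⟩
  S ℚ.* δ ℚ.+ T ℚ.* η
    ≡⟨ cong₂ ℚ._+_ Sδ≡½ε Tη≡½ε ⟩
  ½ ℚ.* ε ℚ.+ ½ ℚ.* ε
    ≡⟨ halves ε ⟩
  ε ∎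
  where open ℚₚ.≤-Reasoning

infix  4 _≈_ _≤_
infixl 6 _+_ _-_
infixl 7 _*_
infix  8 -_

record _≈_ (x y : ℝ) : Set where
  constructor mk≈
  field
    ∣x-y∣<ε : ∀ ε → 0ℚ ℚ.< ε →
      ∃[ N ] (∀ n → N ℕ.≤ n → ∣ seq x n ℚ.- seq y n ∣ ℚ.< ε)

record _≤_ (x y : ℝ) : Set where
  constructor mk≤
  field
    x<y+ε : ∀ ε → 0ℚ ℚ.< ε →
      ∃[ N ] (∀ n → N ℕ.≤ n → seq x n ℚ.< seq y n ℚ.+ ε)

open _≈_ public
open _≤_ public

fromℚ : ℚ → ℝ
fromℚ q = mkℝ (λ _ → q) (const-cauchy q)

fromℤ : ℤ → ℝ
fromℤ z = fromℚ (z ℚ./ 1)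

0ℝ 1ℝ : ℝ
0ℝ = fromℚ 0ℚ
1ℝ = fromℚ 1ℚ

_+_ _*_ : ℝ → ℝ → ℝ
x + y = mkℝ (λ n → seq x n ℚ.+ seq y n) (+-cauchy (seq x) (seq y) (cauchy x) (cauchy y))
x * y = mkℝ (λ n → seq x n ℚ.* seq y n) (*-cauchy (seq x) (seq y) (cauchy x) (cauchy y))

-_ : ℝ → ℝ
- x = mkℝ (λ n → ℚ.- seq x n) (neg-cauchy (seq x) (cauchy x))

_-_ : ℝ → ℝ → ℝ
x - y = x + (- y)

+-0-rawMonoid : RawMonoid 0ℓ 0ℓ
+-0-rawMonoid = record { Carrier = ℝ ; _≈_ = _≈_ ; _∙_ = _+_ ; ε = 0ℝ }

open RawMonoidDefs +-0-rawMonoid public using (sum)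

ℝ^ : ℕ → Set
ℝ^ d = Vector ℝ d

Subset : ℕ → Set₁
Subset d = Pred (ℝ^ d) 0ℓ

infix 4 _≋_

_≋_ : ∀ {d} → Rel (ℝ^ d) 0ℓ
_≋_ = Pointwise _≈_

infixl 7 _·_

_·_ : ∀ {d} → ℝ → ℝ^ d → ℝ^ d
r · x = map (r *_) x

sumᵛ : ∀ {d n} → Vector (ℝ^ d) n → ℝ^ d
sumᵛ xs j = sum (λ i → xs i j)

Lattice : ∀ {d} → Subset d
Lattice {d} x = ∃ λ (z : Vector ℤ d) → x ≋ map fromℤ z

-- A linear form on ℝᵈ is given by its coefficient vector.
LinearForm : ℕ → Set
LinearForm d = ℝ^ d

_⟨_⟩ : ∀ {d} → LinearForm d → ℝ^ d → ℝ
l ⟨ x ⟩ = sum (zipWith _*_ l x)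

FullRank : ∀ {d} → Vector (LinearForm d) d → Set
FullRank {d} l = (c : Vector ℝ d) →
  sumᵛ (λ i → c i · l i) ≋ (λ _ → 0ℝ) → c ≋ (λ _ → 0ℝ)

IsEllipsoid : ∀ {d} → Subset d → Set
IsEllipsoid {d} E =
  ∃ λ (l : Vector (LinearForm d) d) → ∃ λ (a : Vector ℝ d) →
    FullRank l ×
    E ≐ (λ x → sum (λ i → (l i ⟨ x ⟩ - a i) * (l i ⟨ x ⟩ - a i)) ≈ 1ℝ)

conv : ∀ {d} → Subset d → Subset d
conv {d} S x =
  ∃[ n ] ∃ λ (p : Vector (ℝ^ d) n) → ∃ λ (w : Vector ℝ n) →
    (∀ i → p i ∈ S) × (∀ i → 0ℝ ≤ w i) × sum w ≈ 1ℝ ×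
    x ≋ sumᵛ (λ i → w i · p i)

IsPolytope : ∀ {d} → Subset d → Set
IsPolytope {d} P =
  ∃[ n ] ∃ λ (v : Vector (ℝ^ d) n) → P ≐ conv (λ x → ∃[ i ] x ≋ v i)

-- A vertex is a 0-dimensional face: the only point of P on some
-- hyperplane {u = b} with P contained in {u ≤ b}.  Allowing u = 0
-- makes a one-point P a vertex of itself, as it should be.
IsVertex : ∀ {d} → Subset d → Subset d
IsVertex {d} P x =
  x ∈ P × ∃ λ (u : LinearForm d) → ∃[ b ]
    (∀ y → y ∈ P → u ⟨ y ⟩ ≤ b) ×
    u ⟨ x ⟩ ≈ b ×
    (∀ y → y ∈ P → u ⟨ y ⟩ ≈ b → y ≋ x)

IsLatticePolytope : ∀ {d} → Subset d → Set
IsLatticePolytope P = IsPolytope P × (∀ x → x ∈ IsVertex P → x ∈ Lattice)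

dilate : ∀ {d} → ℕ → Subset d → Subset d
dilate {d} c P x = ∃ λ (p : ℝ^ d) → p ∈ P × x ≋ fromℤ (+ c) · p

IsNormal : ∀ {d} → Subset d → Set
IsNormal {d} P = IsLatticePolytope P ×
  (∀ (c : ℕ) x → x ∈ dilate c P → x ∈ Lattice →
    ∃ λ (xs : Vector (ℝ^ d) c) → (∀ i → xs i ∈ P × xs i ∈ Lattice) × sumᵛ xs ≋ x)

-- P(E): for an ellipsoid E, conv E is the solid ellipsoid it bounds.
latticeHull : ∀ {d} → Subset d → Subset d
latticeHull E = conv (conv E ∩ Lattice)

module Submission where

-- The lattice points of the hull generate a sublattice of index two in Λ. Normality as defined here
-- asks for a decomposition of every point of Λ in the dilate, so one missed coset defeats it.
-- Dimension four is the obstacle: there (½, ½, ½, ½) has squared length exactly 1, lies in the ball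
-- and fills the gap. In lattice coordinates the coset is a matter of parity. The doubled Euclidean
-- coordinates of a point of Λ are integers of one common parity, and the first of them is the first
-- lattice coordinate itself. A sum of points of ℤᵈ therefore has an even first lattice coordinate,
-- whereas the point to be decomposed has 1. The constructive reals shape the rest. Their order is
-- not decidable, so the proof that vertices of the hull are lattice points cannot simply pick a
-- nonzero weight of a convex combination; it has to find one with an explicit positive rational
-- lower bound.

-- For d ≥ 5 the lattice Λ = ℤᵈ + ℤ (½, …, ½) meets the closed unit ball only in 0 and ±eᵢ, because a
-- point with half-odd coordinates has squared norm at least d/4 > 1.  The lattice points of the hull
-- therefore lie in ℤᵈ, as do all their sums, while (½, …, ½) = d · Σᵢ (1/2d) eᵢ is a point of Λ in its
-- d-th dilate.  A linear isomorphism ℤᵈ → Λ turns the unit sphere into the required ellipsoid.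

import Algebra.Definitions.RawMonoid as RawMonoidDefs
import Algebra.Properties.Ring as RingProperties
import Algebra.Properties.Semiring.Sum as SemiringSum
import Data.Integer.Properties as ℤₚ
import Data.Nat.Base as ℕ
import Data.Nat.Properties as ℕₚ
import Data.Rational.Properties as ℚₚ
import Data.Rational.Unnormalised.Properties as ℚᵘₚ
import Relation.Binary.Reasoning.PartialOrder as PartialOrderReasoning
import Relation.Binary.Reasoning.Setoid as SetoidReasoning
open import Algebra.Bundles using (CommutativeRing)
open import Algebra.Morphism.Structures using (IsRingHomomorphism)
open import Algebra.Properties.AbelianGroup ℤₚ.+-0-abelianGroup using (∙-cancelʳ)
open import Algebra.Structures using (IsCommutativeRing)
open import Data.Fin.Base using (Fin; zero; suc; combine; remQuot)
open import Data.Fin.Patterns using (0F; 1F; 2F)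
open import Data.Fin.Properties using (remQuot-combine)
open import Data.Integer.Base as ℤ using (ℤ; +_; -[1+_]; 0ℤ; 1ℤ; -1ℤ)
open import Data.Integer.DivMod using (_/ℕ_; _%ℕ_; n%ℕd<d; a≡a%ℕn+[a/ℕn]*n)
open import Data.Integer.Solver using () renaming (module +-*-Solver to ℤ-Solver)
open import Data.Nat using (ℕ; _≥_)
open import Data.Product using (∃-syntax; _×_)
open import Data.Product.Base using (∃; _,_; proj₁; proj₂; uncurry)
open import Data.Rational.Base as ℚ using (ℚ; 0ℚ; 1ℚ; ½; ∣_∣)
open import Data.Rational.Solver using (module +-*-Solver)
open import Data.Rational.Unnormalised.Base as ℚᵘ using (mkℚᵘ)
open import Data.Sum.Base using (_⊎_; inj₁; inj₂)
open import Data.Vec.Functional using (Vector; foldr; map)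
open import Function.Base using (_∘_; id)
open import Level using (0ℓ)
open import Relation.Binary.Bundles using (Poset)
open import Relation.Binary.Core using (Rel)
open import Relation.Binary.PropositionalEquality as ≡
  using (_≡_; _≢_; cong; cong₂; subst; subst₂)
open import Relation.Binary.Structures using (IsPartialOrder)
open import Relation.Nullary using (¬_)
open import Relation.Nullary.Negation using (contradiction)
open import Relation.Unary using (_∈_; _∩_)

-- Finite sums, dot products and the Kronecker delta over a commutative ring.

module RingSums (R : CommutativeRing 0ℓ 0ℓ) where
  open CommutativeRing R hiding (zero)
  open SemiringSum semiring using (sum; sum-cong-≋; ∑-comm; *-distribˡ-sum; sum-replicate-zero)
  open SetoidReasoning setoid

  infix 7 _∙_

  _∙_ : ∀ {n} → Vector Carrier n → Vector Carrier n → Carrier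
  u ∙ x = sum (λ j → u j * x j)

  ∙-cong : ∀ {n} {u v x y : Vector Carrier n} →
           (∀ j → u j ≈ v j) → (∀ j → x j ≈ y j) → u ∙ x ≈ v ∙ y
  ∙-cong u≈v x≈y = sum-cong-≋ λ j → *-cong (u≈v j) (x≈y j)

  x∙[y*z]≈y∙[x*z] : ∀ x y z → x * (y * z) ≈ y * (x * z)
  x∙[y*z]≈y∙[x*z] x y z = begin
    x * (y * z)    ≈⟨ *-assoc x y z ⟨
    (x * y) * z    ≈⟨ *-congʳ (*-comm x y) ⟩
    (y * x) * z    ≈⟨ *-assoc y x z ⟩
    y * (x * z)    ∎

  -- Linearity of `u ∙_` after exchanging the two sums. It serves for the coordinate forms, for the
  -- supporting functional at a vertex, and with `u` the combination itself in the convexity of the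
  -- ball.
  ∙-combination : ∀ {n d} (u : Vector Carrier d) (w : Vector Carrier n)
    (p : Fin n → Vector Carrier d) {x : Vector Carrier d} →
    (∀ j → x j ≈ sum (λ i → w i * p i j)) → u ∙ x ≈ w ∙ (λ i → u ∙ p i)
  ∙-combination u w p {x} x≈ = begin
    sum (λ j → u j * x j)                          ≈⟨ sum-cong-≋ (λ j → *-congˡ (x≈ j)) ⟩
    sum (λ j → u j * sum (λ i → w i * p i j))      ≈⟨ sum-cong-≋ (λ j → *-distribˡ-sum (u j) (λ i → w i * p i j)) ⟩
    sum (λ j → sum (λ i → u j * (w i * p i j)))    ≈⟨ ∑-comm (λ j i → u j * (w i * p i j)) ⟩
    sum (λ i → sum (λ j → u j * (w i * p i j)))    ≈⟨ sum-cong-≋ (λ i → sum-cong-≋ λ j → x∙[y*z]≈y∙[x*z] (u j) (w i) (p i j)) ⟩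
    sum (λ i → sum (λ j → w i * (u j * p i j)))    ≈⟨ sum-cong-≋ (λ i → *-distribˡ-sum (w i) (λ j → u j * p i j)) ⟨
    sum (λ i → w i * sum (λ j → u j * p i j))      ∎

  -- Lets sums folded with one addition be replaced by sums over an equivalent one; it is what
  -- carries sums of reals over to the opaque operations.
  foldr≈sum : ∀ {_⊞_ : Carrier → Carrier → Carrier} → (∀ x y → x ⊞ y ≈ x + y) →
              ∀ {n} (f : Vector Carrier n) → foldr _⊞_ 0# f ≈ sum f
  foldr≈sum ⊞≈+ {0}       f = refl
  foldr≈sum ⊞≈+ {ℕ.suc n} f = trans (⊞≈+ (f zero) _) (+-congˡ (foldr≈sum ⊞≈+ (f ∘ suc)))

  δ : ∀ {n} → Fin n → Fin n → Carrier
  δ zero    zero    = 1#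
  δ zero    (suc j) = 0#
  δ (suc i) zero    = 0#
  δ (suc i) (suc j) = δ i j

  sum-zero : ∀ {n} {f : Vector Carrier n} → (∀ i → f i ≈ 0#) → sum f ≈ 0#
  sum-zero {n} f≈0 = trans (sum-cong-≋ f≈0) (sum-replicate-zero n)

  δ-∙ : ∀ {n} (i : Fin n) x → δ i ∙ x ≈ x i
  δ-∙ zero x = begin
    1# * x zero + sum (λ j → 0# * x (suc j))    ≈⟨ +-cong (*-identityˡ (x zero)) (sum-zero λ j → zeroˡ (x (suc j))) ⟩
    x zero + 0#                                 ≈⟨ +-identityʳ (x zero) ⟩
    x zero                                      ∎
  δ-∙ (suc i) x = begin
    0# * x zero + δ i ∙ (x ∘ suc)    ≈⟨ +-cong (zeroˡ (x zero)) (δ-∙ i (x ∘ suc)) ⟩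
    0# + x (suc i)                   ≈⟨ +-identityˡ (x (suc i)) ⟩
    x (suc i)                        ∎

  δ-sym : ∀ {n} (i j : Fin n) → δ i j ≡ δ j i
  δ-sym zero    zero    = ≡.refl
  δ-sym zero    (suc j) = ≡.refl
  δ-sym (suc i) zero    = ≡.refl
  δ-sym (suc i) (suc j) = δ-sym i j

  ∙-δ : ∀ {n} x (j : Fin n) → x ∙ (λ i → δ i j) ≈ x j
  ∙-δ x j = begin
    x ∙ (λ i → δ i j)    ≈⟨ sum-cong-≋ (λ i → *-comm (x i) (δ i j)) ⟩
    (λ i → δ i j) ∙ x    ≈⟨ ∙-cong (λ i → reflexive (δ-sym i j)) (λ _ → refl) ⟩
    δ j ∙ x              ≈⟨ δ-∙ j x ⟩
    x j                  ∎

-- Partially ordered rings: averages and convexity of the unit ball.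

record OrderedRing : Set₁ where
  infix 4 _≤_
  field
    commutativeRing : CommutativeRing 0ℓ 0ℓ
  open CommutativeRing commutativeRing public hiding (zero)
  field
    _≤_              : Rel Carrier 0ℓ
    ≤-isPartialOrder : IsPartialOrder _≈_ _≤_
    +-mono-≤         : ∀ {x y u v} → x ≤ y → u ≤ v → x + u ≤ y + v
    *-nonNeg         : ∀ {x y} → 0# ≤ x → 0# ≤ y → 0# ≤ x * y
    2xy≤xx+yy        : ∀ x y → x * y + x * y ≤ x * x + y * y

  ≤-poset : Poset 0ℓ 0ℓ 0ℓ
  ≤-poset = record { isPartialOrder = ≤-isPartialOrder }

module OrderedRingProperties (R : OrderedRing) where
  open OrderedRing R
  open SemiringSum semiring using (sum; sum-cong-≋; ∑-distrib-+; *-distribˡ-sum; *-distribʳ-sum)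
  open RingProperties ring using (-‿distribʳ-*; -1*x≈-x)
  open RingSums commutativeRing
  open IsPartialOrder ≤-isPartialOrder using (antisym) renaming (refl to ≤-refl)
  open PartialOrderReasoning ≤-poset

  y-x+x≈y : ∀ x y → (y - x) + x ≈ y
  y-x+x≈y x y = begin-equality
    (y - x) + x      ≈⟨ +-assoc y (- x) x ⟩
    y + (- x + x)    ≈⟨ +-congˡ (-‿inverseˡ x) ⟩
    y + 0#           ≈⟨ +-identityʳ y ⟩
    y                ∎

  0≤y-x⇒x≤y : ∀ {x y} → 0# ≤ y - x → x ≤ y
  0≤y-x⇒x≤y {x} {y} 0≤y-x = begin
    x              ≈⟨ +-identityˡ x ⟨
    0# + x         ≤⟨ +-mono-≤ 0≤y-x ≤-refl ⟩
    (y - x) + x    ≈⟨ y-x+x≈y x y ⟩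
    y              ∎

  x≤y⇒0≤y-x : ∀ {x y} → x ≤ y → 0# ≤ y - x
  x≤y⇒0≤y-x {x} {y} x≤y = begin
    0#       ≈⟨ -‿inverseʳ x ⟨
    x - x    ≤⟨ +-mono-≤ x≤y ≤-refl ⟩
    y - x    ∎

  *-distribˡ-- : ∀ x y z → x * (y - z) ≈ x * y - x * z
  *-distribˡ-- x y z = trans (distribˡ x y (- z)) (+-congˡ (sym (-‿distribʳ-* x z)))

  *-monoˡ-≤ : ∀ {x y z} → 0# ≤ z → x ≤ y → z * x ≤ z * y
  *-monoˡ-≤ {x} {y} {z} 0≤z x≤y = 0≤y-x⇒x≤y (begin
    0#               ≤⟨ *-nonNeg 0≤z (x≤y⇒0≤y-x x≤y) ⟩
    z * (y - x)      ≈⟨ *-distribˡ-- z y x ⟩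
    z * y - z * x    ∎)

  *-monoʳ-≤ : ∀ {x y z} → 0# ≤ z → x ≤ y → x * z ≤ y * z
  *-monoʳ-≤ {x} {y} {z} 0≤z x≤y = begin
    x * z    ≈⟨ *-comm x z ⟩
    z * x    ≤⟨ *-monoˡ-≤ 0≤z x≤y ⟩
    z * y    ≈⟨ *-comm z y ⟩
    y * z    ∎

  sum-mono-≤ : ∀ {n} {f g : Vector Carrier n} → (∀ i → f i ≤ g i) → sum f ≤ sum g
  sum-mono-≤ {ℕ.zero}  f≤g = ≤-refl
  sum-mono-≤ {ℕ.suc n} f≤g = +-mono-≤ (f≤g zero) (sum-mono-≤ (f≤g ∘ suc))

  sum-nonNeg : ∀ {n} {f : Vector Carrier n} → (∀ i → 0# ≤ f i) → 0# ≤ sum f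
  sum-nonNeg {n} {f} 0≤f = begin
    0#                    ≈⟨ sum-zero {n} (λ _ → refl) ⟨
    sum {n} (λ _ → 0#)    ≤⟨ sum-mono-≤ 0≤f ⟩
    sum f                 ∎

  term≤sum : ∀ {n} {f : Vector Carrier n} → (∀ i → 0# ≤ f i) → ∀ i → f i ≤ sum f
  term≤sum {f = f} 0≤f zero = begin
    f zero                    ≈⟨ +-identityʳ (f zero) ⟨
    f zero + 0#               ≤⟨ +-mono-≤ ≤-refl (sum-nonNeg (0≤f ∘ suc)) ⟩
    f zero + sum (f ∘ suc)    ∎
  term≤sum {f = f} 0≤f (suc i) = begin
    f (suc i)                 ≈⟨ +-identityˡ (f (suc i)) ⟨
    0# + f (suc i)            ≤⟨ +-mono-≤ (0≤f zero) (term≤sum (0≤f ∘ suc) i) ⟩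
    f zero + sum (f ∘ suc)    ∎

  average-≤ : ∀ {n} {w f : Vector Carrier n} {b} → (∀ i → 0# ≤ w i) → sum w ≈ 1# →
              (∀ i → f i ≤ b) → w ∙ f ≤ b
  average-≤ {w = w} {f} {b} 0≤w Σw≈1 f≤b = begin
    w ∙ f                  ≤⟨ sum-mono-≤ (λ i → *-monoˡ-≤ (0≤w i) (f≤b i)) ⟩
    sum (λ i → w i * b)    ≈⟨ *-distribʳ-sum b w ⟨
    sum w * b              ≈⟨ *-congʳ Σw≈1 ⟩
    1# * b                 ≈⟨ *-identityˡ b ⟩
    b                      ∎

  ∙-AM-GM : ∀ {d} (u v : Vector Carrier d) → u ∙ v + u ∙ v ≤ u ∙ u + v ∙ v
  ∙-AM-GM u v = begin
    u ∙ v + u ∙ v                        ≈⟨ ∑-distrib-+ (λ j → u j * v j) (λ j → u j * v j) ⟨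
    sum (λ j → u j * v j + u j * v j)    ≤⟨ sum-mono-≤ (λ j → 2xy≤xx+yy (u j) (v j)) ⟩
    sum (λ j → u j * u j + v j * v j)    ≈⟨ ∑-distrib-+ (λ j → u j * u j) (λ j → v j * v j) ⟩
    u ∙ u + v ∙ v                        ∎

  +-cancelʳ-≤ : ∀ {x y} z → x + z ≤ y + z → x ≤ y
  +-cancelʳ-≤ {x} {y} z x+z≤y+z = begin
    x              ≈⟨ x+z-z≈x x ⟨
    (x + z) - z    ≤⟨ +-mono-≤ x+z≤y+z ≤-refl ⟩
    (y + z) - z    ≈⟨ x+z-z≈x y ⟩
    y              ∎
    where
    x+z-z≈x : ∀ x → (x + z) - z ≈ x
    x+z-z≈x x = trans (+-assoc x z (- z)) (trans (+-congˡ (-‿inverseʳ z)) (+-identityʳ x))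

  -- Replacing Cauchy–Schwarz by 2 y∙qᵢ ≤ y∙y + qᵢ∙qᵢ and averaging over i gives 2 y∙y ≤ y∙y + 1.
  unitBall-convex : ∀ {n d} {w : Vector Carrier n} {q : Fin n → Vector Carrier d} {y} →
    (∀ i → 0# ≤ w i) → sum w ≈ 1# → (∀ j → y j ≈ sum (λ i → w i * q i j)) →
    (∀ i → q i ∙ q i ≤ 1#) → y ∙ y ≤ 1#
  unitBall-convex {w = w} {q} {y} 0≤w Σw≈1 y≈ q≤1 = +-cancelʳ-≤ (y ∙ y) (begin
    y ∙ y + y ∙ y                                    ≈⟨ +-cong y∙y≈ y∙y≈ ⟩
    w ∙ (λ i → y ∙ q i) + w ∙ (λ i → y ∙ q i)        ≈⟨ ∑-distrib-+ (λ i → w i * (y ∙ q i)) (λ i → w i * (y ∙ q i)) ⟨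
    sum (λ i → w i * (y ∙ q i) + w i * (y ∙ q i))    ≈⟨ sum-cong-≋ (λ i → distribˡ (w i) (y ∙ q i) (y ∙ q i)) ⟨
    w ∙ (λ i → y ∙ q i + y ∙ q i)                    ≤⟨ average-≤ 0≤w Σw≈1 (λ i → bound i) ⟩
    1# + y ∙ y                                       ∎)
    where
    y∙y≈ : y ∙ y ≈ w ∙ (λ i → y ∙ q i)
    y∙y≈ = ∙-combination y w q y≈
    bound : ∀ i → y ∙ q i + y ∙ q i ≤ 1# + y ∙ y
    bound i = begin
      y ∙ q i + y ∙ q i    ≤⟨ ∙-AM-GM y (q i) ⟩
      y ∙ y + q i ∙ q i    ≤⟨ +-mono-≤ ≤-refl (q≤1 i) ⟩
      y ∙ y + 1#           ≈⟨ +-comm (y ∙ y) 1# ⟩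
      1# + y ∙ y           ∎

  -- The gaps `w k * (b - f k)` are nonnegative and sum to zero, so each of them is at most zero. To
  -- cancel the weight, `q` bounds `w i` from below and `r` inverts `q`; this is the usable form of
  -- positivity of `w i` without division or a decidable order.
  average-attained : ∀ {n} {w f : Vector Carrier n} {b} →
    (∀ i → 0# ≤ w i) → sum w ≈ 1# → (∀ i → f i ≤ b) → w ∙ f ≈ b →
    ∀ i {q r} → q ≤ w i → 0# ≤ r → r * q ≈ 1# → f i ≈ b
  average-attained {w = w} {f} {b} 0≤w Σw≈1 f≤b wf≈b i {q} {r} q≤wᵢ 0≤r rq≈1 =
    antisym (f≤b i) (+-cancelʳ-≤ (- f i) (begin
      b - f i                      ≈⟨ *-identityˡ (b - f i) ⟨
      1# * (b - f i)               ≈⟨ *-congʳ rq≈1 ⟨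
      (r * q) * (b - f i)          ≈⟨ *-assoc r q (b - f i) ⟩
      r * (q * (b - f i))          ≤⟨ *-monoˡ-≤ 0≤r (*-monoʳ-≤ (0≤gap i) q≤wᵢ) ⟩
      r * (w i * (b - f i))        ≤⟨ *-monoˡ-≤ 0≤r (term≤sum (λ k → *-nonNeg (0≤w k) (0≤gap k)) i) ⟩
      r * (w ∙ (λ k → b - f k))    ≈⟨ *-congˡ total-gap ⟩
      r * 0#                       ≈⟨ zeroʳ r ⟩
      0#                           ≈⟨ -‿inverseʳ (f i) ⟨
      f i - f i                    ∎))
    where
    0≤gap : ∀ k → 0# ≤ b - f k
    0≤gap k = x≤y⇒0≤y-x (f≤b k)
    total-gap : w ∙ (λ k → b - f k) ≈ 0#
    total-gap = begin-equality
      w ∙ (λ k → b - f k)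
        ≈⟨ sum-cong-≋ (λ k → distribˡ (w k) b (- f k)) ⟩
      sum (λ k → w k * b + w k * - f k)
        ≈⟨ ∑-distrib-+ (λ k → w k * b) (λ k → w k * - f k) ⟩
      w ∙ (λ _ → b) + w ∙ (λ k → - f k)
        ≈⟨ +-cong (sym (*-distribʳ-sum b w)) (sum-cong-≋ (λ k → trans (*-congˡ (sym (-1*x≈-x (f k)))) (x∙[y*z]≈y∙[x*z] (w k) (- 1#) (f k)))) ⟩
      sum w * b + sum (λ k → - 1# * (w k * f k))
        ≈⟨ +-cong (*-congʳ Σw≈1) (sym (*-distribˡ-sum (- 1#) (λ k → w k * f k))) ⟩
      1# * b + - 1# * (w ∙ f)
        ≈⟨ +-cong (*-identityˡ b) (trans (*-congˡ wf≈b) (-1*x≈-x b)) ⟩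
      b - b
        ≈⟨ -‿inverseʳ b ⟩
      0# ∎

-- Integer coordinates: parity and short vectors.

open RawMonoidDefs ℕ.+-0-rawMonoid using () renaming (sum to sumℕ)
open RingSums ℤₚ.+-*-commutativeRing using () renaming (δ to δℤ)

squareSum : ∀ {n} → Vector ℤ n → ℕ
squareSum m = sumℕ (λ i → ℤ.∣ m i ∣ ℕ.* ℤ.∣ m i ∣)

-- A vector z ∈ ℤᵈ stands for the point (z₀ / 2, z₁ + z₀ / 2, …, z_{d-1} + z₀ / 2) of
-- ℤᵈ + ℤ (½, …, ½); its doubled coordinates are integers of equal parity.
double : ∀ {m} → Vector ℤ (ℕ.suc m) → Vector ℤ (ℕ.suc m)
double z zero    = z zero
double z (suc i) = (z (suc i) ℤ.+ z (suc i)) ℤ.+ z zero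

-- Stands for the standard basis vector eᵢ.
unit : ∀ {m} → Fin (ℕ.suc m) → Vector ℤ (ℕ.suc m)
unit i zero    = δℤ i zero ℤ.+ δℤ i zero
unit i (suc j) = δℤ i (suc j) ℤ.- δℤ i zero

-- Stands for (½, …, ½).
deep : ∀ {m} → Vector ℤ (ℕ.suc m)
deep = δℤ zero

-- The value 0 is included so that the origin and all ±eᵢ form a single finite family indexed by
-- `Fin 3` and a coordinate.
sgn : Fin 3 → ℤ
sgn 0F = 0ℤ
sgn 1F = 1ℤ
sgn 2F = -1ℤ

+-double-injective : ∀ {i j} → i ℤ.+ i ≡ j ℤ.+ j → i ≡ j
+-double-injective {i} {j} eq = ℤₚ.*-cancelˡ-≡ (+ 2) i j
  (≡.trans (twice i) (≡.trans eq (≡.sym (twice j))))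
  where
  open ℤ-Solver
  twice : ∀ i → + 2 ℤ.* i ≡ i ℤ.+ i
  twice = solve 1 (λ i → con (+ 2) :* i := i :+ i) ≡.refl

double-injective : ∀ {m} {y z : Vector ℤ (ℕ.suc m)} →
                   (∀ i → double y i ≡ double z i) → ∀ i → y i ≡ z i
double-injective         eq zero    = eq zero
double-injective {y = y} {z} eq (suc i) = +-double-injective
  (∙-cancelʳ (z zero) (y (suc i) ℤ.+ y (suc i)) (z (suc i) ℤ.+ z (suc i))
    (≡.trans (cong (λ x → (y (suc i) ℤ.+ y (suc i)) ℤ.+ x) (≡.sym (eq zero))) (eq (suc i))))

-- In the later coordinates the term subtracted in `unit` is doubled and then cancelled by the first
-- coordinate that `double` adds, which explains the shape (2, -1, ..., -1) of `unit zero`.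
double-unit : ∀ {m} s (i j : Fin (ℕ.suc m)) →
  double (λ k → s ℤ.* unit i k) j ≡ s ℤ.* δℤ i j ℤ.+ s ℤ.* δℤ i j
double-unit s i zero    = ℤₚ.*-distribˡ-+ s (δℤ i zero) (δℤ i zero)
double-unit s i (suc j) =
  solve 3 (λ s a b → (s :* (a :- b) :+ s :* (a :- b)) :+ s :* (b :+ b) := s :* a :+ s :* a)
    ≡.refl s (δℤ i (suc j)) (δℤ i zero)
  where open ℤ-Solver

-- In the case `even` the point lies in ℤᵈ and `k` lists its Euclidean coordinates; `odd` is the
-- coset of (½, ..., ½).
data Parity {m} (z : Vector ℤ (ℕ.suc m)) : Set where
  even : ∀ (k : Vector ℤ (ℕ.suc m)) → (∀ i → double z i ≡ k i ℤ.+ k i) → Parity z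
  odd  : ∀ (k : Vector ℤ (ℕ.suc m)) → (∀ i → double z i ≡ 1ℤ ℤ.+ (k i ℤ.+ k i)) → Parity z

-- Every later doubled coordinate differs from `z zero` by an even number, so a single division of
-- `z zero` by 2 settles all of them.
parity : ∀ {m} (z : Vector ℤ (ℕ.suc m)) → Parity z
parity {m} z = go (z zero %ℕ 2) (n%ℕd<d (z zero) 2) (a≡a%ℕn+[a/ℕn]*n (z zero) 2)
  where
  open ℤ-Solver
  q = z zero /ℕ 2
  k : Vector ℤ (ℕ.suc m)
  k zero    = q
  k (suc i) = z (suc i) ℤ.+ q
  go : ∀ r → r ℕ.< 2 → z zero ≡ + r ℤ.+ q ℤ.* + 2 → Parity z
  go 0 _ eq = even k λ
    { zero    → ≡.trans eq (solve 1 (λ q → con 0ℤ :+ q :* con (+ 2) := q :+ q) ≡.refl q)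
    ; (suc i) → ≡.trans (cong (λ x → (z (suc i) ℤ.+ z (suc i)) ℤ.+ x) eq)
        (solve 2 (λ x q → (x :+ x) :+ (con 0ℤ :+ q :* con (+ 2)) := (x :+ q) :+ (x :+ q)) ≡.refl (z (suc i)) q) }
  go 1 _ eq = odd k λ
    { zero    → ≡.trans eq (solve 1 (λ q → con 1ℤ :+ q :* con (+ 2) := con 1ℤ :+ (q :+ q)) ≡.refl q)
    ; (suc i) → ≡.trans (cong (λ x → (z (suc i) ℤ.+ z (suc i)) ℤ.+ x) eq)
        (solve 2 (λ x q → (x :+ x) :+ (con 1ℤ :+ q :* con (+ 2)) := con 1ℤ :+ ((x :+ q) :+ (x :+ q))) ≡.refl (z (suc i)) q) }
  go (ℕ.suc (ℕ.suc r)) (ℕ.s≤s (ℕ.s≤s ())) eq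

n≤sum : ∀ {n} {f : Vector ℕ n} → (∀ i → 1 ℕ.≤ f i) → n ℕ.≤ sumℕ f
n≤sum {0}       _   = ℕ.z≤n
n≤sum {ℕ.suc n} 1≤f = ℕₚ.+-mono-≤ (1≤f zero) (n≤sum (1≤f ∘ suc))

odd-square : ∀ k → let i = 1ℤ ℤ.+ (k ℤ.+ k) in 1 ℕ.≤ ℤ.∣ i ∣ ℕ.* ℤ.∣ i ∣
odd-square (+ n)    = ℕ.s≤s ℕ.z≤n
odd-square -[1+ n ] = ℕ.s≤s ℕ.z≤n

-- An odd integer is nonzero, so each of the `n` entries contributes at least 1. This is where the
-- dimension enters.
squareSum-odd : ∀ {n} {m k : Vector ℤ n} → (∀ i → m i ≡ 1ℤ ℤ.+ (k i ℤ.+ k i)) → n ℕ.≤ squareSum m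
squareSum-odd {k = k} m≡ = n≤sum λ i →
  subst (λ j → 1 ℕ.≤ ℤ.∣ j ∣ ℕ.* ℤ.∣ j ∣) (≡.sym (m≡ i)) (odd-square (k i))

squareSum≤0 : ∀ {n} {m : Vector ℤ n} → squareSum m ℕ.≤ 0 → ∀ i → m i ≡ 0ℤ
squareSum≤0 {ℕ.suc n} {m} ≤0 i with m zero in eq
squareSum≤0 {ℕ.suc n} {m} ≤0 zero    | + 0 = eq
squareSum≤0 {ℕ.suc n} {m} ≤0 (suc i) | + 0 = squareSum≤0 {m = m ∘ suc} ≤0 i
squareSum≤0 {ℕ.suc n} {m} () i | ℤ.+[1+ _ ]
squareSum≤0 {ℕ.suc n} {m} () i | -[1+ _ ]

-- A nonzero head exhausts the bound, which forces it to be ±1 and the tail to vanish; a zero head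
-- passes the bound on to the tail.
squareSum≤1 : ∀ {n} {m : Vector ℤ n} → squareSum m ℕ.≤ 1 →
  (∀ j → m j ≡ 0ℤ) ⊎ (∃[ s ] ∃[ i ] ∀ j → m j ≡ sgn s ℤ.* δℤ i j)
squareSum≤1 {0} _ = inj₁ λ ()
squareSum≤1 {ℕ.suc n} {m} ≤1 with m zero in eq
... | + 0 with squareSum≤1 {m = m ∘ suc} ≤1
...   | inj₁ m≡0          = inj₁ λ { zero → eq ; (suc j) → m≡0 j }
...   | inj₂ (s , i , m≡) = inj₂ (s , suc i ,
          λ { zero → ≡.trans eq (≡.sym (ℤₚ.*-zeroʳ (sgn s))) ; (suc j) → m≡ j })
squareSum≤1 {ℕ.suc n} {m} (ℕ.s≤s ≤0) | + 1 = inj₂ (1F , zero ,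
  λ { zero → eq ; (suc j) → squareSum≤0 {m = m ∘ suc} ≤0 j })
squareSum≤1 {ℕ.suc n} {m} (ℕ.s≤s ≤0) | -[1+ 0 ] = inj₂ (2F , zero ,
  λ { zero → eq ; (suc j) → squareSum≤0 {m = m ∘ suc} ≤0 j })
squareSum≤1 {ℕ.suc n} {m} (ℕ.s≤s ()) | + ℕ.suc (ℕ.suc _)
squareSum≤1 {ℕ.suc n} {m} (ℕ.s≤s ()) | -[1+ ℕ.suc _ ]

squareSum-zero : ∀ {n} {m : Vector ℤ n} → (∀ i → m i ≡ 0ℤ) → squareSum m ≡ 0
squareSum-zero {0}       _   = ≡.refl
squareSum-zero {ℕ.suc n} m≡0 = cong₂ ℕ._+_ (cong (λ i → ℤ.∣ i ∣ ℕ.* ℤ.∣ i ∣) (m≡0 zero)) (squareSum-zero (m≡0 ∘ suc))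

squareSum-δ : ∀ {n} s (i : Fin n) → squareSum (λ j → s ℤ.* δℤ i j) ≡ ℤ.∣ s ∣ ℕ.* ℤ.∣ s ∣
squareSum-δ {ℕ.suc n} s zero = ≡.trans
  (cong₂ ℕ._+_ (cong (λ i → ℤ.∣ i ∣ ℕ.* ℤ.∣ i ∣) (ℤₚ.*-identityʳ s)) (squareSum-zero {n} λ _ → ℤₚ.*-zeroʳ s))
  (ℕₚ.+-identityʳ _)
squareSum-δ s (suc i) = cong₂ ℕ._+_ (cong (λ i → ℤ.∣ i ∣ ℕ.* ℤ.∣ i ∣) (ℤₚ.*-zeroʳ s)) (squareSum-δ s i)

-- The half-integer lattice and its quadratic form over a ring containing ½.

module HalfLattice (R : CommutativeRing 0ℓ 0ℓ)
  {ι : ℤ → CommutativeRing.Carrier R}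
  (ι-homo : IsRingHomomorphism ℤ.+-*-rawRing (CommutativeRing.rawRing R) ι)
  {½ : CommutativeRing.Carrier R}
  (½+½≈1 : CommutativeRing._≈_ R (CommutativeRing._+_ R ½ ½) (CommutativeRing.1# R))
  where
  open CommutativeRing R hiding (zero)
  open IsRingHomomorphism ι-homo
  open SemiringSum semiring using (sum; sum-cong-≋; ∑-distrib-+)
  open RingProperties ring using (+-identityˡ-unique)
  open RingSums R
  open SetoidReasoning setoid

  -- The Euclidean coordinates as linear forms: ½x₀ and xᵢ + ½x₀. The first basis vector goes to (½,
  -- ..., ½) and the others to e₁, e₂, ...; these generate Λ because e₀ is twice the first image
  -- minus the sum of the others.
  form : ∀ {m} → Fin (ℕ.suc m) → Vector Carrier (ℕ.suc m)
  form zero    zero    = ½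
  form zero    (suc j) = 0#
  form (suc i) zero    = ½
  form (suc i) (suc j) = δ i j

  halves-sum : ∀ x → ½ * x + ½ * x ≈ x
  halves-sum x = begin
    ½ * x + ½ * x    ≈⟨ distribʳ x ½ ½ ⟨
    (½ + ½) * x      ≈⟨ *-congʳ ½+½≈1 ⟩
    1# * x           ≈⟨ *-identityˡ x ⟩
    x                ∎

  x+x≈y+y⇒x≈y : ∀ {x y} → x + x ≈ y + y → x ≈ y
  x+x≈y+y⇒x≈y {x} {y} eq = begin
    x                ≈⟨ halves-sum x ⟨
    ½ * x + ½ * x    ≈⟨ distribˡ ½ x x ⟨
    ½ * (x + x)      ≈⟨ *-congˡ eq ⟩
    ½ * (y + y)      ≈⟨ distribˡ ½ y y ⟩
    ½ * y + ½ * y    ≈⟨ halves-sum y ⟩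
    y                ∎

  -- The system is triangular: each later column meets one form only and kills its coefficient,
  -- after which the first column reads ½ · `c zero` = 0.
  form-independent : ∀ {m} (c : Vector Carrier (ℕ.suc m)) →
    (∀ j → sum (λ i → c i * form i j) ≈ 0#) → ∀ i → c i ≈ 0#
  form-independent c dep (suc k) = begin
    c (suc k)                                      ≈⟨ ∙-δ (c ∘ suc) k ⟨
    sum (λ i → c (suc i) * δ i k)                  ≈⟨ +-identityˡ _ ⟨
    0# + sum (λ i → c (suc i) * δ i k)             ≈⟨ +-congʳ (zeroʳ (c zero)) ⟨
    c zero * 0# + sum (λ i → c (suc i) * δ i k)    ≈⟨ dep (suc k) ⟩
    0#                                             ∎
  form-independent c dep zero = begin
    c zero                     ≈⟨ halves-sum (c zero) ⟨
    ½ * c zero + ½ * c zero    ≈⟨ +-cong ½c≈0 ½c≈0 ⟩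
    0# + 0#                    ≈⟨ +-identityˡ 0# ⟩
    0#                         ∎
    where
    ½c≈0 : ½ * c zero ≈ 0#
    ½c≈0 = begin
      ½ * c zero
        ≈⟨ *-comm ½ (c zero) ⟩
      c zero * ½
        ≈⟨ +-identityʳ (c zero * ½) ⟨
      c zero * ½ + 0#
        ≈⟨ +-congˡ (sum-zero λ i → trans (*-congʳ (form-independent c dep (suc i))) (zeroˡ ½)) ⟨
      c zero * ½ + sum (λ i → c (suc i) * ½)
        ≈⟨ dep zero ⟩
      0# ∎

  form-double : ∀ {m} (i : Fin (ℕ.suc m)) z →
    form i ∙ (ι ∘ z) + form i ∙ (ι ∘ z) ≈ ι (double z i)
  form-double zero z = begin
    form zero ∙ (ι ∘ z) + form zero ∙ (ι ∘ z)    ≈⟨ +-cong eq eq ⟩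
    ½ * ι (z zero) + ½ * ι (z zero)              ≈⟨ halves-sum (ι (z zero)) ⟩
    ι (z zero)                                   ∎
    where
    eq : form zero ∙ (ι ∘ z) ≈ ½ * ι (z zero)
    eq = trans (+-congˡ (sum-zero λ j → zeroˡ (ι (z (suc j))))) (+-identityʳ _)
  form-double (suc i) z = begin
    form (suc i) ∙ (ι ∘ z) + form (suc i) ∙ (ι ∘ z)    ≈⟨ +-cong eq eq ⟩
    (ι (z (suc i)) + ½ * ι (z zero)) + (ι (z (suc i)) + ½ * ι (z zero))
      ≈⟨ interchange (ι (z (suc i))) (½ * ι (z zero)) (ι (z (suc i))) (½ * ι (z zero)) ⟩
    (ι (z (suc i)) + ι (z (suc i))) + (½ * ι (z zero) + ½ * ι (z zero))
      ≈⟨ +-cong (sym (+-homo (z (suc i)) (z (suc i)))) (halves-sum (ι (z zero))) ⟩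
    ι (z (suc i) ℤ.+ z (suc i)) + ι (z zero)    ≈⟨ +-homo (z (suc i) ℤ.+ z (suc i)) (z zero) ⟨
    ι (double z (suc i))                        ∎
    where
    open import Algebra.Properties.CommutativeSemigroup +-commutativeSemigroup using (interchange)
    eq : form (suc i) ∙ (ι ∘ z) ≈ ι (z (suc i)) + ½ * ι (z zero)
    eq = trans (+-congˡ (δ-∙ i (ι ∘ z ∘ suc))) (+-comm _ _)

  form-even : ∀ {m} (i : Fin (ℕ.suc m)) z {k} → double z i ≡ k ℤ.+ k → form i ∙ (ι ∘ z) ≈ ι k
  form-even i z {k} eq = x+x≈y+y⇒x≈y (begin
    form i ∙ (ι ∘ z) + form i ∙ (ι ∘ z)    ≈⟨ form-double i z ⟩
    ι (double z i)                         ≈⟨ ⟦⟧-cong eq ⟩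
    ι (k ℤ.+ k)                            ≈⟨ +-homo k k ⟩
    ι k + ι k                              ∎)

  ι-squareSum : ∀ {n} (k : Vector ℤ n) → sum (λ i → ι (k i) * ι (k i)) ≈ ι (+ squareSum k)
  ι-squareSum {0}       k = sym 0#-homo
  ι-squareSum {ℕ.suc n} k = begin
    ι (k zero) * ι (k zero) + sum (λ i → ι (k (suc i)) * ι (k (suc i)))
      ≈⟨ +-cong (sym (*-homo (k zero) (k zero))) (ι-squareSum (k ∘ suc)) ⟩
    ι (k zero ℤ.* k zero) + ι (+ squareSum (k ∘ suc))
      ≈⟨ +-homo (k zero ℤ.* k zero) (+ squareSum (k ∘ suc)) ⟨
    ι (k zero ℤ.* k zero ℤ.+ + squareSum (k ∘ suc))
      ≈⟨ ⟦⟧-cong (cong (ℤ._+ + squareSum (k ∘ suc)) (square-abs (k zero))) ⟩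
    ι (+ squareSum k) ∎
    where
    square-abs : ∀ i → i ℤ.* i ≡ + (ℤ.∣ i ∣ ℕ.* ℤ.∣ i ∣)
    square-abs (+ n)    = ≡.sym (ℤₚ.pos-* n n)
    square-abs -[1+ n ] = ≡.refl

  -- The squared Euclidean length of the point of Λ, with no root taken.
  norm : ∀ {m} → Vector Carrier (ℕ.suc m) → Carrier
  norm x = sum (λ i → (form i ∙ x) * (form i ∙ x))

  norm-even : ∀ {m} (z k : Vector ℤ (ℕ.suc m)) → (∀ i → double z i ≡ k i ℤ.+ k i) →
              norm (ι ∘ z) ≈ ι (+ squareSum k)
  norm-even z k eq = trans
    (sum-cong-≋ λ i → *-cong (form-even i z {k i} (eq i)) (form-even i z {k i} (eq i))) (ι-squareSum k)

  -- Doubling every Euclidean coordinate multiplies the squared length by four and clears the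
  -- denominators, so that the ball condition becomes an inequality between integers.
  4norm : ∀ {m} (z : Vector ℤ (ℕ.suc m)) → let N = norm (ι ∘ z) in
          (N + N) + (N + N) ≈ ι (+ squareSum (double z))
  4norm z = begin
    (N + N) + (N + N)
      ≈⟨ +-cong N+N N+N ⟩
    sum (λ i → L i * L i + L i * L i) + sum (λ i → L i * L i + L i * L i)
      ≈⟨ ∑-distrib-+ (λ i → L i * L i + L i * L i) (λ i → L i * L i + L i * L i) ⟨
    sum (λ i → (L i * L i + L i * L i) + (L i * L i + L i * L i))
      ≈⟨ sum-cong-≋ (λ i → +-cong (sym (distribˡ (L i) (L i) (L i))) (sym (distribˡ (L i) (L i) (L i)))) ⟩
    sum (λ i → L i * (L i + L i) + L i * (L i + L i))
      ≈⟨ sum-cong-≋ (λ i → sym (distribʳ (L i + L i) (L i) (L i))) ⟩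
    sum (λ i → (L i + L i) * (L i + L i))
      ≈⟨ sum-cong-≋ (λ i → *-cong (form-double i z) (form-double i z)) ⟩
    sum (λ i → ι (double z i) * ι (double z i))
      ≈⟨ ι-squareSum (double z) ⟩
    ι (+ squareSum (double z)) ∎
    where
    N = norm (ι ∘ z)
    L : Vector Carrier _
    L i = form i ∙ (ι ∘ z)
    N+N : N + N ≈ sum (λ i → L i * L i + L i * L i)
    N+N = sym (∑-distrib-+ (λ i → L i * L i) (λ i → L i * L i))

  ι-δ : ∀ {n} (i j : Fin n) → ι (δℤ i j) ≈ δ i j
  ι-δ zero    zero    = 1#-homo
  ι-δ zero    (suc j) = 0#-homo
  ι-δ (suc i) zero    = 0#-homo
  ι-δ (suc i) (suc j) = ι-δ i j

  sum-const : ∀ n x → sum {n} (λ _ → x) ≈ ι (+ n) * x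
  sum-const 0         x = sym (trans (*-congʳ 0#-homo) (zeroˡ x))
  sum-const (ℕ.suc n) x = begin
    x + sum {n} (λ _ → x)    ≈⟨ +-cong (sym (*-identityˡ x)) (sum-const n x) ⟩
    1# * x + ι (+ n) * x     ≈⟨ distribʳ x 1# (ι (+ n)) ⟨
    (1# + ι (+ n)) * x       ≈⟨ *-congʳ (+-congʳ 1#-homo) ⟨
    (ι 1ℤ + ι (+ n)) * x     ≈⟨ *-congʳ (+-homo 1ℤ (+ n)) ⟨
    ι (+ ℕ.suc n) * x        ∎

  -- This is ½τ · Σᵢ eᵢ = τ · (½, ..., ½) in lattice coordinates. In the first coordinate only e₀
  -- contributes, namely 2; in each other coordinate the -1 of e₀ cancels against the 1 of one other
  -- unit. The factor `sgn 1F` makes the terms agree with those of `vtx 1F`.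
  sum-units : ∀ {m} τ (j : Fin (ℕ.suc m)) →
    sum (λ i → (½ * τ) * ι (sgn 1F ℤ.* unit i j)) ≈ τ * ι (deep j)
  sum-units {m} τ zero = begin
    sum {ℕ.suc m} (λ i → (½ * τ) * ι (sgn 1F ℤ.* unit i zero))    ≈⟨ sum-cong-≋ {ℕ.suc m} term ⟩
    sum {ℕ.suc m} (λ i → τ * δ i zero)                            ≈⟨ ∙-δ {ℕ.suc m} (λ _ → τ) zero ⟩
    τ                                                             ≈⟨ *-identityʳ τ ⟨
    τ * 1#                                                        ≈⟨ *-congˡ 1#-homo ⟨
    τ * ι 1ℤ                                                      ∎
    where
    term : ∀ (i : Fin (ℕ.suc m)) → (½ * τ) * ι (sgn 1F ℤ.* unit i zero) ≈ τ * δ i zero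
    term i = begin
      (½ * τ) * ι (sgn 1F ℤ.* unit i zero)         ≈⟨ *-congˡ (⟦⟧-cong (ℤₚ.*-identityˡ (unit i zero))) ⟩
      (½ * τ) * ι (δℤ i zero ℤ.+ δℤ i zero)        ≈⟨ *-congˡ (+-homo (δℤ i zero) (δℤ i zero)) ⟩
      (½ * τ) * (ι (δℤ i zero) + ι (δℤ i zero))    ≈⟨ *-congˡ (+-cong (ι-δ i zero) (ι-δ i zero)) ⟩
      (½ * τ) * (δ i zero + δ i zero)              ≈⟨ distribˡ (½ * τ) (δ i zero) (δ i zero) ⟩
      (½ * τ) * δ i zero + (½ * τ) * δ i zero      ≈⟨ distribʳ (δ i zero) (½ * τ) (½ * τ) ⟨
      (½ * τ + ½ * τ) * δ i zero                   ≈⟨ *-congʳ (halves-sum τ) ⟩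
      τ * δ i zero                                 ∎
  -- Adding Σᵢ c · `δ i zero`, which is c, undoes the subtraction in `unit`; what remains is again
  -- c, so the original sum is zero.
  sum-units {m} τ (suc j) = trans (+-identityˡ-unique _ c (begin
    sum {ℕ.suc m} (λ i → c * ι (sgn 1F ℤ.* unit i (suc j))) + c
      ≈⟨ +-congˡ (∙-δ {ℕ.suc m} (λ _ → c) zero) ⟨
    sum {ℕ.suc m} (λ i → c * ι (sgn 1F ℤ.* unit i (suc j))) + sum {ℕ.suc m} (λ i → c * δ i zero)
      ≈⟨ ∑-distrib-+ {ℕ.suc m} (λ i → c * ι (sgn 1F ℤ.* unit i (suc j))) (λ i → c * δ i zero) ⟨
    sum {ℕ.suc m} (λ i → c * ι (sgn 1F ℤ.* unit i (suc j)) + c * δ i zero)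
      ≈⟨ sum-cong-≋ {ℕ.suc m} term ⟩
    sum {ℕ.suc m} (λ i → c * δ i (suc j))
      ≈⟨ ∙-δ {ℕ.suc m} (λ _ → c) (suc j) ⟩
    c ∎))
    (sym (trans (*-congˡ 0#-homo) (zeroʳ τ)))
    where
    c = ½ * τ
    cancel : ∀ a b → 1ℤ ℤ.* (a ℤ.- b) ℤ.+ b ≡ a
    cancel = solve 2 (λ a b → con 1ℤ :* (a :- b) :+ b := a) ≡.refl
      where open ℤ-Solver
    term : ∀ (i : Fin (ℕ.suc m)) → c * ι (sgn 1F ℤ.* unit i (suc j)) + c * δ i zero ≈ c * δ i (suc j)
    term i = begin
      c * ι (sgn 1F ℤ.* unit i (suc j)) + c * δ i zero       ≈⟨ distribˡ c _ (δ i zero) ⟨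
      c * (ι (sgn 1F ℤ.* unit i (suc j)) + δ i zero)         ≈⟨ *-congˡ (+-congˡ (ι-δ i zero)) ⟨
      c * (ι (sgn 1F ℤ.* unit i (suc j)) + ι (δℤ i zero))    ≈⟨ *-congˡ (+-homo (sgn 1F ℤ.* unit i (suc j)) (δℤ i zero)) ⟨
      c * ι (sgn 1F ℤ.* unit i (suc j) ℤ.+ δℤ i zero)        ≈⟨ *-congˡ (⟦⟧-cong (cancel (δℤ i (suc j)) (δℤ i zero))) ⟩
      c * ι (δℤ i (suc j))                                   ≈⟨ *-congˡ (ι-δ i (suc j)) ⟩
      c * δ i (suc j)                                        ∎

  -- Closure of ℤᵈ under addition, as seen in the first lattice coordinate alone.
  sum-even : ∀ {n} {f : Vector Carrier n} → (∀ i → ∃[ k ] f i ≈ ι (k ℤ.+ k)) →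
             ∃[ k ] sum f ≈ ι (k ℤ.+ k)
  sum-even {0}             _      = 0ℤ , sym 0#-homo
  sum-even {ℕ.suc n} {f} f-even with f-even zero | sum-even (f-even ∘ suc)
  ... | k , f₀≈ | l , ∑≈ = k ℤ.+ l , (begin
    f zero + sum (f ∘ suc)         ≈⟨ +-cong f₀≈ ∑≈ ⟩
    ι (k ℤ.+ k) + ι (l ℤ.+ l)      ≈⟨ +-homo (k ℤ.+ k) (l ℤ.+ l) ⟨
    ι ((k ℤ.+ k) ℤ.+ (l ℤ.+ l))    ≈⟨ ⟦⟧-cong (interchange k k l l) ⟩
    ι ((k ℤ.+ l) ℤ.+ (k ℤ.+ l))    ∎)
    where
    open import Algebra.Properties.CommutativeSemigroup ℤₚ.+-commutativeSemigroup using (interchange)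

-- Order and arithmetic of the Cauchy reals.

open import Defs
open +-*-Solver using (solve; con; _:=_; _:+_; _:*_; _:-_; :-_)

Eventually : (ℕ → Set) → Set
Eventually P = ∃[ N ] (∀ n → N ℕ.≤ n → P n)

both : ∀ {P Q R : ℕ → Set} → (∀ n → P n → Q n → R n) →
       Eventually P → Eventually Q → Eventually R
both f (M , p) (N , q) = M ℕ.⊔ N , λ n M⊔N≤n →
  f n (p n (ℕₚ.m⊔n≤o⇒m≤o M N M⊔N≤n)) (q n (ℕₚ.m⊔n≤o⇒n≤o M N M⊔N≤n))

always : ∀ {P : ℕ → Set} → (∀ n → P n) → Eventually P
always p = 0 , λ n _ → p n

q<q+ε : ∀ q {ε} → 0ℚ ℚ.< ε → q ℚ.< q ℚ.+ ε
q<q+ε q {ε} 0<ε = subst (ℚ._< q ℚ.+ ε) (ℚₚ.+-identityʳ q) (ℚₚ.+-monoʳ-< q 0<ε)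

q≤∣q∣ : ∀ q → q ℚ.≤ ∣ q ∣
q≤∣q∣ q with ℚₚ.≤-total 0ℚ q
... | inj₁ 0≤q = ℚₚ.≤-reflexive (≡.sym (ℚₚ.0≤p⇒∣p∣≡p 0≤q))
... | inj₂ q≤0 = ℚₚ.≤-trans q≤0 (ℚₚ.0≤∣p∣ q)

q+[p-q]≡p : ∀ p q → q ℚ.+ (p ℚ.- q) ≡ p
q+[p-q]≡p = solve 2 (λ p q → q :+ (p :- q) := p) ≡.refl

≤-pointwise : ∀ {x y} → (∀ n → seq x n ℚ.≤ seq y n) → x ≤ y
≤-pointwise {x} {y} h = mk≤ λ ε 0<ε →
  always λ n → ℚₚ.≤-<-trans (h n) (q<q+ε (seq y n) 0<ε)

≤-trans : ∀ {x y z} → x ≤ y → y ≤ z → x ≤ z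
≤-trans {x} {y} {z} x≤y y≤z = mk≤ λ ε 0<ε →
  both (λ n p q → ℚₚ.<-trans p (step ε n q))
       (x<y+ε x≤y (½ ℚ.* ε) (half-pos 0<ε)) (x<y+ε y≤z (½ ℚ.* ε) (half-pos 0<ε))
  where
  open ℚₚ.≤-Reasoning
  step : ∀ ε n → seq y n ℚ.< seq z n ℚ.+ ½ ℚ.* ε → seq y n ℚ.+ ½ ℚ.* ε ℚ.< seq z n ℚ.+ ε
  step ε n p = begin-strict
    seq y n ℚ.+ ½ ℚ.* ε                  <⟨ ℚₚ.+-monoˡ-< (½ ℚ.* ε) p ⟩
    (seq z n ℚ.+ ½ ℚ.* ε) ℚ.+ ½ ℚ.* ε    ≡⟨ ℚₚ.+-assoc (seq z n) _ _ ⟩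
    seq z n ℚ.+ (½ ℚ.* ε ℚ.+ ½ ℚ.* ε)    ≡⟨ cong (seq z n ℚ.+_) (halves ε) ⟩
    seq z n ℚ.+ ε                        ∎

≈⇒≤ : ∀ {x y} → x ≈ y → x ≤ y
≈⇒≤ {x} {y} x≈y = mk≤ λ ε 0<ε → let N , h = ∣x-y∣<ε x≈y ε 0<ε in N , λ n N≤n → begin-strict
  seq x n                                ≡⟨ q+[p-q]≡p (seq x n) (seq y n) ⟨
  seq y n ℚ.+ (seq x n ℚ.- seq y n)      ≤⟨ ℚₚ.+-monoʳ-≤ (seq y n) (q≤∣q∣ _) ⟩
  seq y n ℚ.+ ∣ seq x n ℚ.- seq y n ∣    <⟨ ℚₚ.+-monoʳ-< (seq y n) (h n N≤n) ⟩
  seq y n ℚ.+ ε                          ∎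
  where open ℚₚ.≤-Reasoning

-- Turns `≈` into a two-sided `≤`, so that transitivity of `≈` and its compatibility with addition
-- follow from the order without further ε-estimates.
≤-antisym : ∀ {x y} → x ≤ y → y ≤ x → x ≈ y
≤-antisym {x} {y} x≤y y≤x = mk≈ λ ε 0<ε →
  both (λ n → close {ε} (seq x n) (seq y n)) (x<y+ε x≤y ε 0<ε) (x<y+ε y≤x ε 0<ε)
  where
  open ℚₚ.≤-Reasoning
  gap : ∀ {ε} p q → p ℚ.< q ℚ.+ ε → p ℚ.- q ℚ.< ε
  gap {ε} p q p<q+ε = begin-strict
    p ℚ.- q            <⟨ ℚₚ.+-monoˡ-< (ℚ.- q) p<q+ε ⟩
    (q ℚ.+ ε) ℚ.- q    ≡⟨ solve 2 (λ q e → (q :+ e) :- q := e) ≡.refl q ε ⟩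
    ε                  ∎
  close : ∀ {ε} p q → p ℚ.< q ℚ.+ ε → q ℚ.< p ℚ.+ ε → ∣ p ℚ.- q ∣ ℚ.< ε
  close {ε} p q p<q+ε q<p+ε with ℚₚ.∣p∣≡p∨∣p∣≡-p (p ℚ.- q)
  ... | inj₁ eq = subst (ℚ._< ε) (≡.sym eq) (gap p q p<q+ε)
  ... | inj₂ eq = subst (ℚ._< ε)
    (≡.sym (≡.trans eq (solve 2 (λ p q → :- (p :- q) := q :- p) ≡.refl p q))) (gap q p q<p+ε)

≈-pointwise : ∀ {x y} → (∀ n → seq x n ≡ seq y n) → x ≈ y
≈-pointwise h = ≤-antisym (≤-pointwise (ℚₚ.≤-reflexive ∘ h))
                          (≤-pointwise (ℚₚ.≤-reflexive ∘ ≡.sym ∘ h))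

≈-refl : ∀ {x} → x ≈ x
≈-refl = ≈-pointwise λ _ → ≡.refl

≈-sym : ∀ {x y} → x ≈ y → y ≈ x
≈-sym {x} {y} x≈y = mk≈ λ ε 0<ε → let N , h = ∣x-y∣<ε x≈y ε 0<ε in
  N , λ n N≤n → subst (ℚ._< ε) (flip-abs (seq x n) (seq y n)) (h n N≤n)
  where
  flip-abs : ∀ p q → ∣ p ℚ.- q ∣ ≡ ∣ q ℚ.- p ∣
  flip-abs p q = ≡.trans (≡.sym (ℚₚ.∣-p∣≡∣p∣ (p ℚ.- q)))
    (cong ∣_∣ (solve 2 (λ p q → :- (p :- q) := q :- p) ≡.refl p q))

≈⇒≥ : ∀ {x y} → x ≈ y → y ≤ x
≈⇒≥ = ≈⇒≤ ∘ ≈-sym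

≈-trans : ∀ {x y z} → x ≈ y → y ≈ z → x ≈ z
≈-trans x≈y y≈z =
  ≤-antisym (≤-trans (≈⇒≤ x≈y) (≈⇒≤ y≈z)) (≤-trans (≈⇒≥ y≈z) (≈⇒≥ x≈y))

+-mono-≤ : ∀ {x y u v} → x ≤ y → u ≤ v → x + u ≤ y + v
+-mono-≤ {x} {y} {u} {v} x≤y u≤v = mk≤ λ ε 0<ε →
  both (λ n p q → begin-strict
         seq x n ℚ.+ seq u n                                <⟨ ℚₚ.+-mono-< p q ⟩
         (seq y n ℚ.+ ½ ℚ.* ε) ℚ.+ (seq v n ℚ.+ ½ ℚ.* ε)    ≡⟨ regroup (seq y n) (seq v n) ε ⟩
         (seq y n ℚ.+ seq v n) ℚ.+ ε                        ∎)
       (x<y+ε x≤y (½ ℚ.* ε) (half-pos 0<ε)) (x<y+ε u≤v (½ ℚ.* ε) (half-pos 0<ε))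
  where
  open ℚₚ.≤-Reasoning
  regroup : ∀ p q ε → (p ℚ.+ ½ ℚ.* ε) ℚ.+ (q ℚ.+ ½ ℚ.* ε) ≡ (p ℚ.+ q) ℚ.+ ε
  regroup = solve 3 (λ p q e → (p :+ con ½ :* e) :+ (q :+ con ½ :* e) := (p :+ q) :+ e) ≡.refl

+-cong : ∀ {x y u v} → x ≈ y → u ≈ v → x + u ≈ y + v
+-cong x≈y u≈v = ≤-antisym (+-mono-≤ (≈⇒≤ x≈y) (≈⇒≤ u≈v)) (+-mono-≤ (≈⇒≥ x≈y) (≈⇒≥ u≈v))

-‿cong : ∀ {x y} → x ≈ y → - x ≈ - y
-‿cong {x} {y} x≈y = mk≈ λ ε 0<ε → let N , h = ∣x-y∣<ε x≈y ε 0<ε in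
  N , λ n N≤n → subst (ℚ._< ε) (eq (seq x n) (seq y n)) (h n N≤n)
  where
  eq : ∀ p q → ∣ p ℚ.- q ∣ ≡ ∣ (ℚ.- p) ℚ.- (ℚ.- q) ∣
  eq p q = ≡.trans (≡.sym (ℚₚ.∣-p∣≡∣p∣ (p ℚ.- q))) (cong ∣_∣ (ℚₚ.neg-distrib-+ p (ℚ.- q)))

*-comm : ∀ x y → x * y ≈ y * x
*-comm x y = ≈-pointwise λ n → ℚₚ.*-comm (seq x n) (seq y n)

*-congˡ : ∀ z {x y} → x ≈ y → z * x ≈ z * y
*-congˡ z {x} {y} x≈y = mk≈ λ ε 0<ε →
  let B , 0<B , z<B  = bounded (seq z) (cauchy z)
      δ , 0<δ , Bδ≡ε = divide 0<B 0<ε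
  in both (λ n → bound (seq z n) (seq x n) (seq y n) 0<B Bδ≡ε) z<B (∣x-y∣<ε x≈y δ 0<δ)
  where
  open ℚₚ.≤-Reasoning
  factor : ∀ r p q → r ℚ.* p ℚ.- r ℚ.* q ≡ r ℚ.* (p ℚ.- q)
  factor = solve 3 (λ r p q → r :* p :- r :* q := r :* (p :- q)) ≡.refl
  bound : ∀ r p q {B δ ε} → 0ℚ ℚ.< B → B ℚ.* δ ≡ ε →
          ∣ r ∣ ℚ.< B → ∣ p ℚ.- q ∣ ℚ.< δ → ∣ r ℚ.* p ℚ.- r ℚ.* q ∣ ℚ.< ε
  bound r p q {B} {δ} {ε} 0<B Bδ≡ε r<B pq<δ = begin-strict
    ∣ r ℚ.* p ℚ.- r ℚ.* q ∣    ≡⟨ cong ∣_∣ (factor r p q) ⟩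
    ∣ r ℚ.* (p ℚ.- q) ∣        <⟨ ∣*∣-mono-< {r} {p ℚ.- q} 0<B r<B pq<δ ⟩
    B ℚ.* δ                    ≡⟨ Bδ≡ε ⟩
    ε                          ∎

*-cong : ∀ {x y u v} → x ≈ y → u ≈ v → x * u ≈ y * v
*-cong {x} {y} {u} {v} x≈y u≈v =
  ≈-trans {x * u} {x * v} {y * v} (*-congˡ x {u} {v} u≈v)
    (≈-trans {x * v} {v * x} {y * v} (*-comm x v)
      (≈-trans {v * x} {v * y} {y * v} (*-congˡ v {x} {y} x≈y) (*-comm v y)))

-- Approximations p, q of x, y exceed -δ, and (p + δ)(q + δ) > 0 gives pq > -(p + q + δ)δ. With |p|
-- < B, |q| < C and δ < 1 the bracket is at most D = B + C + 1 + ε, and δ = ε/D makes the error ε.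
-- The summand ε in D ensures δ < 1.
*-nonNeg : ∀ {x y} → 0ℝ ≤ x → 0ℝ ≤ y → 0ℝ ≤ x * y
*-nonNeg {x} {y} 0≤x 0≤y = mk≤ λ ε 0<ε →
  let B , 0<B , x<B = bounded (seq x) (cauchy x)
      C , 0<C , y<C = bounded (seq y) (cauchy y)
      δ , 0<δ , Dδ≡ε = divide (0<D 0<B 0<C 0<ε) 0<ε
  in both (λ n (p , p′) (q , q′) → bound (seq x n) (seq y n) 0<B 0<C 0<ε 0<δ Dδ≡ε p p′ q q′)
          (both (λ _ → _,_) (x<y+ε 0≤x δ 0<δ) x<B)
          (both (λ _ → _,_) (x<y+ε 0≤y δ 0<δ) y<C)
  where
  open ℚₚ.≤-Reasoning

  0<B+C+1 : ∀ {B C} → 0ℚ ℚ.< B → 0ℚ ℚ.< C → 0ℚ ℚ.< (B ℚ.+ C) ℚ.+ 1ℚ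
  0<B+C+1 0<B 0<C = ℚₚ.+-mono-< (ℚₚ.+-mono-< 0<B 0<C) (ℚₚ.positive⁻¹ 1ℚ)

  0<D : ∀ {B C ε} → 0ℚ ℚ.< B → 0ℚ ℚ.< C → 0ℚ ℚ.< ε → 0ℚ ℚ.< ((B ℚ.+ C) ℚ.+ 1ℚ) ℚ.+ ε
  0<D 0<B 0<C 0<ε = ℚₚ.+-mono-< (0<B+C+1 0<B 0<C) 0<ε

  expand : ∀ p q δ → (p ℚ.+ δ) ℚ.* (q ℚ.+ δ) ≡ p ℚ.* q ℚ.+ ((p ℚ.+ q) ℚ.+ δ) ℚ.* δ
  expand = solve 3 (λ p q d → (p :+ d) :* (q :+ d) := p :* q :+ ((p :+ q) :+ d) :* d) ≡.refl

  bound : ∀ p q {B C ε δ} → 0ℚ ℚ.< B → 0ℚ ℚ.< C → 0ℚ ℚ.< ε → 0ℚ ℚ.< δ →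
          (((B ℚ.+ C) ℚ.+ 1ℚ) ℚ.+ ε) ℚ.* δ ≡ ε →
          0ℚ ℚ.< p ℚ.+ δ → ∣ p ∣ ℚ.< B → 0ℚ ℚ.< q ℚ.+ δ → ∣ q ∣ ℚ.< C → 0ℚ ℚ.< p ℚ.* q ℚ.+ ε
  bound p q {B} {C} {ε} {δ} 0<B 0<C 0<ε 0<δ Dδ≡ε 0<p+δ p<B 0<q+δ q<C = begin-strict
    0ℚ                                     <⟨ ℚₚ.positive⁻¹ ((p ℚ.+ δ) ℚ.* (q ℚ.+ δ)) ⟩
    (p ℚ.+ δ) ℚ.* (q ℚ.+ δ)                ≡⟨ expand p q δ ⟩
    p ℚ.* q ℚ.+ ((p ℚ.+ q) ℚ.+ δ) ℚ.* δ    ≤⟨ ℚₚ.+-monoʳ-≤ (p ℚ.* q) (ℚₚ.*-monoʳ-≤-nonNeg δ sum≤D) ⟩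
    p ℚ.* q ℚ.+ D ℚ.* δ                    ≡⟨ cong (p ℚ.* q ℚ.+_) Dδ≡ε ⟩
    p ℚ.* q ℚ.+ ε                          ∎
    where
    D = ((B ℚ.+ C) ℚ.+ 1ℚ) ℚ.+ ε
    instance
      p+δ-pos  = ℚ.positive 0<p+δ
      q+δ-pos  = ℚ.positive 0<q+δ
      prod-pos = ℚₚ.pos*pos⇒pos (p ℚ.+ δ) (q ℚ.+ δ)
      δ-nonNeg = ℚ.nonNegative (ℚₚ.<⇒≤ 0<δ)
    δ<1 : δ ℚ.< 1ℚ
    δ<1 = ℚₚ.*-cancelˡ-<-nonNeg D {{ℚ.nonNegative (ℚₚ.<⇒≤ (0<D 0<B 0<C 0<ε))}} (begin-strict
      D ℚ.* δ     ≡⟨ Dδ≡ε ⟩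
      ε           <⟨ q<q+ε ε (0<B+C+1 0<B 0<C) ⟩
      ε ℚ.+ _     ≡⟨ ℚₚ.+-comm ε ((B ℚ.+ C) ℚ.+ 1ℚ) ⟩
      D           ≡⟨ ℚₚ.*-identityʳ D ⟨
      D ℚ.* 1ℚ    ∎)
    sum≤D : (p ℚ.+ q) ℚ.+ δ ℚ.≤ D
    sum≤D = begin
      (p ℚ.+ q) ℚ.+ δ    ≤⟨ ℚₚ.+-mono-≤ (ℚₚ.+-mono-≤ (ℚₚ.≤-trans (q≤∣q∣ p) (ℚₚ.<⇒≤ p<B))
                                                       (ℚₚ.≤-trans (q≤∣q∣ q) (ℚₚ.<⇒≤ q<C))) (ℚₚ.<⇒≤ δ<1) ⟩
      (B ℚ.+ C) ℚ.+ 1ℚ    ≤⟨ ℚₚ.<⇒≤ (q<q+ε _ 0<ε) ⟩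
      D                   ∎

2pq≤pp+qq : ∀ p q → p ℚ.* q ℚ.+ p ℚ.* q ℚ.≤ p ℚ.* p ℚ.+ q ℚ.* q
2pq≤pp+qq p q = begin
  p ℚ.* q ℚ.+ p ℚ.* q                                  ≡⟨ ℚₚ.+-identityʳ (p ℚ.* q ℚ.+ p ℚ.* q) ⟨
  (p ℚ.* q ℚ.+ p ℚ.* q) ℚ.+ 0ℚ                         ≤⟨ ℚₚ.+-monoʳ-≤ (p ℚ.* q ℚ.+ p ℚ.* q) (square-nonNeg (p ℚ.- q)) ⟩
  (p ℚ.* q ℚ.+ p ℚ.* q) ℚ.+ (p ℚ.- q) ℚ.* (p ℚ.- q)    ≡⟨ square p q ⟨
  p ℚ.* p ℚ.+ q ℚ.* q                                  ∎
  where
  open ℚₚ.≤-Reasoning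
  square : ∀ p q → p ℚ.* p ℚ.+ q ℚ.* q ≡ (p ℚ.* q ℚ.+ p ℚ.* q) ℚ.+ (p ℚ.- q) ℚ.* (p ℚ.- q)
  square = solve 2 (λ p q → p :* p :+ q :* q := (p :* q :+ p :* q) :+ (p :- q) :* (p :- q)) ≡.refl
  neg-square : ∀ p → (ℚ.- p) ℚ.* (ℚ.- p) ≡ p ℚ.* p
  neg-square = solve 1 (λ p → (:- p) :* (:- p) := p :* p) ≡.refl
  0≤pp : ∀ p → 0ℚ ℚ.≤ p → 0ℚ ℚ.≤ p ℚ.* p
  0≤pp p 0≤p = ℚₚ.nonNegative⁻¹ (p ℚ.* p) {{ℚₚ.nonNeg*nonNeg⇒nonNeg p {{ℚ.nonNegative 0≤p}} p {{ℚ.nonNegative 0≤p}}}}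
  square-nonNeg : ∀ p → 0ℚ ℚ.≤ p ℚ.* p
  square-nonNeg p with ℚₚ.≤-total 0ℚ p
  ... | inj₁ 0≤p = 0≤pp p 0≤p
  ... | inj₂ p≤0 = subst (0ℚ ℚ.≤_) (neg-square p) (0≤pp (ℚ.- p) (ℚₚ.neg-antimono-≤ p≤0))

-- Comparing one approximation of x with (p + q) / 2 decides between the two overlapping cases.
≤-dichotomy : ∀ x {p q} → p ℚ.< q → fromℚ p ≤ x ⊎ x ≤ fromℚ q
≤-dichotomy x {p} {q} p<q with divide {1ℚ ℚ.+ 1ℚ} (ℚₚ.positive⁻¹ (1ℚ ℚ.+ 1ℚ)) (0<q-p p<q)
  where
  0<q-p : p ℚ.< q → 0ℚ ℚ.< q ℚ.- p
  0<q-p p<q = subst (ℚ._< q ℚ.- p) (ℚₚ.+-inverseʳ p) (ℚₚ.+-monoˡ-< (ℚ.- p) p<q)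
... | γ , 0<γ , 2γ≡q-p with cauchy x γ 0<γ
...   | N , h with ℚₚ.≤-total (p ℚ.+ γ) (seq x N)
...     | inj₁ p+γ≤x = inj₁ (mk≤ λ ε 0<ε → N , λ n N≤n → begin-strict
  p
    ≡⟨ solve 2 (λ p g → p := (p :+ g) :- g) ≡.refl p γ ⟩
  (p ℚ.+ γ) ℚ.- γ
    ≤⟨ ℚₚ.+-monoˡ-≤ (ℚ.- γ) p+γ≤x ⟩
  seq x N ℚ.- γ
    ≤⟨ ℚₚ.+-monoʳ-≤ (seq x N) (ℚₚ.neg-antimono-≤ (ℚₚ.≤-trans (q≤∣q∣ (seq x N ℚ.- seq x n)) (ℚₚ.<⇒≤ (h N n ℕₚ.≤-refl N≤n)))) ⟩
  seq x N ℚ.- (seq x N ℚ.- seq x n)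
    ≡⟨ solve 2 (λ a b → a :- (a :- b) := b) ≡.refl (seq x N) (seq x n) ⟩
  seq x n
    <⟨ q<q+ε (seq x n) 0<ε ⟩
  seq x n ℚ.+ ε ∎)
  where open ℚₚ.≤-Reasoning
...     | inj₂ x≤p+γ = inj₂ (mk≤ λ ε 0<ε → N , λ n N≤n → begin-strict
  seq x n
    ≡⟨ q+[p-q]≡p (seq x n) (seq x N) ⟨
  seq x N ℚ.+ (seq x n ℚ.- seq x N)
    ≤⟨ ℚₚ.+-mono-≤ x≤p+γ (ℚₚ.≤-trans (q≤∣q∣ (seq x n ℚ.- seq x N)) (ℚₚ.<⇒≤ (h n N N≤n ℕₚ.≤-refl))) ⟩
  (p ℚ.+ γ) ℚ.+ γ
    ≡⟨ solve 2 (λ p g → (p :+ g) :+ g := p :+ (con 1ℚ :+ con 1ℚ) :* g) ≡.refl p γ ⟩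
  p ℚ.+ (1ℚ ℚ.+ 1ℚ) ℚ.* γ
    ≡⟨ cong (p ℚ.+_) 2γ≡q-p ⟩
  p ℚ.+ (q ℚ.- p)
    ≡⟨ q+[p-q]≡p q p ⟩
  q
    <⟨ q<q+ε q 0<ε ⟩
  q ℚ.+ ε ∎)
  where open ℚₚ.≤-Reasoning

-- The embedding of the integers.

toℚᵘ-/1 : ∀ i → ℚ.toℚᵘ (i ℚ./ 1) ℚᵘ.≃ mkℚᵘ i 0
toℚᵘ-/1 i = ℚₚ.toℚᵘ-fromℚᵘ (mkℚᵘ i 0)

-- The quotient `i / 1` is normalised and does not reduce for a variable `i`; the unnormalised
-- fraction does, so the homomorphism laws are checked there.
/1-homo-+ : ∀ i j → (i ℤ.+ j) ℚ./ 1 ≡ (i ℚ./ 1) ℚ.+ (j ℚ./ 1)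
/1-homo-+ i j = ℚₚ.toℚᵘ-injective (begin
  ℚ.toℚᵘ ((i ℤ.+ j) ℚ./ 1)
    ≈⟨ toℚᵘ-/1 (i ℤ.+ j) ⟩
  mkℚᵘ (i ℤ.+ j) 0
    ≈⟨ ℚᵘ.*≡* (cong (ℤ._* 1ℤ) (≡.sym (cong₂ ℤ._+_ (ℤₚ.*-identityʳ i) (ℤₚ.*-identityʳ j)))) ⟩
  mkℚᵘ i 0 ℚᵘ.+ mkℚᵘ j 0
    ≈⟨ ℚᵘₚ.+-cong (toℚᵘ-/1 i) (toℚᵘ-/1 j) ⟨
  ℚ.toℚᵘ (i ℚ./ 1) ℚᵘ.+ ℚ.toℚᵘ (j ℚ./ 1)
    ≈⟨ ℚₚ.toℚᵘ-homo-+ (i ℚ./ 1) (j ℚ./ 1) ⟨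
  ℚ.toℚᵘ ((i ℚ./ 1) ℚ.+ (j ℚ./ 1)) ∎)
  where open ℚᵘₚ.≃-Reasoning

/1-homo-* : ∀ i j → (i ℤ.* j) ℚ./ 1 ≡ (i ℚ./ 1) ℚ.* (j ℚ./ 1)
/1-homo-* i j = ℚₚ.toℚᵘ-injective (begin
  ℚ.toℚᵘ ((i ℤ.* j) ℚ./ 1)                  ≈⟨ toℚᵘ-/1 (i ℤ.* j) ⟩
  mkℚᵘ i 0 ℚᵘ.* mkℚᵘ j 0                    ≈⟨ ℚᵘₚ.*-cong (toℚᵘ-/1 i) (toℚᵘ-/1 j) ⟨
  ℚ.toℚᵘ (i ℚ./ 1) ℚᵘ.* ℚ.toℚᵘ (j ℚ./ 1)    ≈⟨ ℚₚ.toℚᵘ-homo-* (i ℚ./ 1) (j ℚ./ 1) ⟨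
  ℚ.toℚᵘ ((i ℚ./ 1) ℚ.* (j ℚ./ 1))          ∎)
  where open ℚᵘₚ.≃-Reasoning

/1-homo-neg : ∀ i → (ℤ.- i) ℚ./ 1 ≡ ℚ.- (i ℚ./ 1)
/1-homo-neg i = ℚₚ.toℚᵘ-injective (begin
  ℚ.toℚᵘ ((ℤ.- i) ℚ./ 1)    ≈⟨ toℚᵘ-/1 (ℤ.- i) ⟩
  ℚᵘ.- mkℚᵘ i 0             ≈⟨ ℚᵘₚ.-‿cong (toℚᵘ-/1 i) ⟨
  ℚᵘ.- ℚ.toℚᵘ (i ℚ./ 1)     ≈⟨ ℚₚ.toℚᵘ-homo‿- (i ℚ./ 1) ⟨
  ℚ.toℚᵘ (ℚ.- (i ℚ./ 1))    ∎)
  where open ℚᵘₚ.≃-Reasoning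

/1-cancel-< : ∀ {i j} → i ℚ./ 1 ℚ.< j ℚ./ 1 → i ℤ.< j
/1-cancel-< {i} {j} i<j = subst₂ ℤ._<_ (ℤₚ.*-identityʳ i) (ℤₚ.*-identityʳ j) (ℚᵘₚ.drop-*<*
  (ℚᵘₚ.<-respˡ-≃ (toℚᵘ-/1 i) (ℚᵘₚ.<-respʳ-≃ (toℚᵘ-/1 j) (ℚₚ.toℚᵘ-mono-< i<j))))

-- Tolerance 1 suffices: at a single index it gives i < j + 1, and the integers are discrete.
fromℤ-cancel-≤ : ∀ {i j} → fromℤ i ≤ fromℤ j → i ℤ.≤ j
fromℤ-cancel-≤ {i} {j} i≤j with x<y+ε i≤j 1ℚ (ℚₚ.positive⁻¹ 1ℚ)
... | N , h = subst (i ℤ.≤_) (cancel j) (ℤₚ.i<j⇒i≤pred[j] (/1-cancel-< {i} {j ℤ.+ 1ℤ}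
  (subst (i ℚ./ 1 ℚ.<_) (≡.sym (/1-homo-+ j 1ℤ)) (h N ℕₚ.≤-refl))))
  where
  cancel : ∀ j → ℤ.pred (j ℤ.+ 1ℤ) ≡ j
  cancel j = ≡.trans (cong ℤ.pred (ℤₚ.+-comm j 1ℤ)) (ℤₚ.pred-suc j)

fromℤ-injective : ∀ {i j} → fromℤ i ≈ fromℤ j → i ≡ j
fromℤ-injective {i} {j} i≈j = ℤₚ.≤-antisym
  (fromℤ-cancel-≤ (≈⇒≤ {fromℤ i} {fromℤ j} i≈j)) (fromℤ-cancel-≤ (≈⇒≥ {fromℤ i} {fromℤ j} i≈j))

-- The reals as an ordered ring with opaque operations.

infixl 6 _⊕_
infixl 7 _⊗_
infix  8 ⊝_

-- Opaque copies of the operations: conversion checking would otherwise unfold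
-- the Cauchy moduli of compound terms.
opaque
  _⊕_ _⊗_ : ℝ → ℝ → ℝ
  _⊕_ = _+_
  _⊗_ = _*_

  ⊝_ : ℝ → ℝ
  ⊝_ = -_

  +≈⊕ : ∀ x y → x + y ≈ x ⊕ y
  +≈⊕ x y = ≈-refl {x + y}

  *≈⊗ : ∀ x y → x * y ≈ x ⊗ y
  *≈⊗ x y = ≈-refl {x * y}

  [x-0]²≈x⊗x : ∀ x → (x - 0ℝ) * (x - 0ℝ) ≈ x ⊗ x
  [x-0]²≈x⊗x x = ≈-pointwise λ n →
    solve 1 (λ p → (p :- con 0ℚ) :* (p :- con 0ℚ) := p :* p) ≡.refl (seq x n)

  ⊕-⊗-isCommutativeRing : IsCommutativeRing _≈_ _⊕_ _⊗_ ⊝_ 0ℝ 1ℝ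
  ⊕-⊗-isCommutativeRing = record
    { isRing = record
      { +-isAbelianGroup = record
        { isGroup = record
          { isMonoid = record
            { isSemigroup = record
              { isMagma = record
                { isEquivalence = record { refl = ≈-refl ; sym = ≈-sym ; trans = ≈-trans }
                ; ∙-cong = +-cong }
              ; assoc = λ x y z → ≈-pointwise λ n → ℚₚ.+-assoc (seq x n) (seq y n) (seq z n) }
            ; identity = (λ x → ≈-pointwise λ n → ℚₚ.+-identityˡ (seq x n))
                       , (λ x → ≈-pointwise λ n → ℚₚ.+-identityʳ (seq x n)) }
          ; inverse = (λ x → ≈-pointwise λ n → ℚₚ.+-inverseˡ (seq x n))
                    , (λ x → ≈-pointwise λ n → ℚₚ.+-inverseʳ (seq x n))
          ; ⁻¹-cong = -‿cong }
        ; comm = λ x y → ≈-pointwise λ n → ℚₚ.+-comm (seq x n) (seq y n) }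
      ; *-cong = *-cong
      ; *-assoc = λ x y z → ≈-pointwise λ n → ℚₚ.*-assoc (seq x n) (seq y n) (seq z n)
      ; *-identity = (λ x → ≈-pointwise λ n → ℚₚ.*-identityˡ (seq x n))
                   , (λ x → ≈-pointwise λ n → ℚₚ.*-identityʳ (seq x n))
      ; distrib = (λ x y z → ≈-pointwise λ n → ℚₚ.*-distribˡ-+ (seq x n) (seq y n) (seq z n))
                , (λ x y z → ≈-pointwise λ n → ℚₚ.*-distribʳ-+ (seq x n) (seq y n) (seq z n)) }
    ; *-comm = *-comm }

  ⊕-mono-≤ : ∀ {x y u v} → x ≤ y → u ≤ v → x ⊕ u ≤ y ⊕ v
  ⊕-mono-≤ = +-mono-≤

  ⊗-nonNeg : ∀ {x y} → 0ℝ ≤ x → 0ℝ ≤ y → 0ℝ ≤ x ⊗ y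
  ⊗-nonNeg = *-nonNeg

  2xy≤xx⊕yy : ∀ x y → x ⊗ y ⊕ x ⊗ y ≤ x ⊗ x ⊕ y ⊗ y
  2xy≤xx⊕yy x y = ≤-pointwise λ n → 2pq≤pp+qq (seq x n) (seq y n)

  fromℚ-+ : ∀ p q → fromℚ (p ℚ.+ q) ≈ fromℚ p ⊕ fromℚ q
  fromℚ-+ p q = ≈-pointwise λ _ → ≡.refl

  fromℚ-* : ∀ p q → fromℚ (p ℚ.* q) ≈ fromℚ p ⊗ fromℚ q
  fromℚ-* p q = ≈-pointwise λ _ → ≡.refl

  fromℚ-neg : ∀ p → fromℚ (ℚ.- p) ≈ ⊝ fromℚ p
  fromℚ-neg p = ≈-pointwise λ _ → ≡.refl

fromℚ-cong : ∀ {p q} → p ≡ q → fromℚ p ≈ fromℚ q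
fromℚ-cong p≡q = ≈-pointwise λ _ → p≡q

ℝ-orderedRing : OrderedRing
ℝ-orderedRing = record
  { commutativeRing  = record { isCommutativeRing = ⊕-⊗-isCommutativeRing }
  ; _≤_              = _≤_
  ; ≤-isPartialOrder = record
    { isPreorder = record
      { isEquivalence = record { refl = ≈-refl ; sym = ≈-sym ; trans = ≈-trans }
      ; reflexive = ≈⇒≤
      ; trans = ≤-trans }
    ; antisym = ≤-antisym }
  ; +-mono-≤  = ⊕-mono-≤
  ; *-nonNeg  = ⊗-nonNeg
  ; 2xy≤xx+yy = 2xy≤xx⊕yy
  }

open OrderedRing ℝ-orderedRing using () renaming (commutativeRing to ℝ-commutativeRing)

fromℤ-homo : IsRingHomomorphism ℤ.+-*-rawRing (CommutativeRing.rawRing ℝ-commutativeRing) fromℤ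
fromℤ-homo = record
  { isSemiringHomomorphism = record
    { isNearSemiringHomomorphism = record
      { +-isMonoidHomomorphism = record
        { isMagmaHomomorphism = record
          { isRelHomomorphism = record { cong = fromℚ-cong ∘ cong (ℚ._/ 1) }
          ; homo = λ i j → ≈-trans (fromℚ-cong (/1-homo-+ i j)) (fromℚ-+ (i ℚ./ 1) (j ℚ./ 1)) }
        ; ε-homo = ≈-refl }
      ; *-homo = λ i j → ≈-trans (fromℚ-cong (/1-homo-* i j)) (fromℚ-* (i ℚ./ 1) (j ℚ./ 1)) }
    ; 1#-homo = ≈-refl }
  ; -‿homo = λ i → ≈-trans (fromℚ-cong (/1-homo-neg i)) (fromℚ-neg (i ℚ./ 1)) }

open RingSums ℝ-commutativeRing
open OrderedRingProperties ℝ-orderedRing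
module ℝ-ring = CommutativeRing ℝ-commutativeRing
open SemiringSum ℝ-ring.semiring using () renaming (sum to ∑; sum-cong-≋ to ∑-cong)

½+½≈1 : fromℚ ½ ⊕ fromℚ ½ ≈ 1ℝ
½+½≈1 = ≈-sym (fromℚ-+ ½ ½)

open HalfLattice ℝ-commutativeRing fromℤ-homo ½+½≈1
open PartialOrderReasoning (OrderedRing.≤-poset ℝ-orderedRing)
open IsRingHomomorphism fromℤ-homo using (1#-homo) renaming (⟦⟧-cong to fromℤ-cong; +-homo to fromℤ-+)

sum≈∑ : ∀ {n} (f : Vector ℝ n) → sum f ≈ ∑ f
sum≈∑ = foldr≈sum +≈⊕

⟨⟩≈∙ : ∀ {d} (u x : ℝ^ d) → u ⟨ x ⟩ ≈ u ∙ x
⟨⟩≈∙ u x = ≈-trans (sum≈∑ (λ j → u j * x j)) (∑-cong λ j → *≈⊗ (u j) (x j))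

combination≈ : ∀ {d n} (w : Vector ℝ n) (p : Vector (ℝ^ d) n) j →
               sumᵛ (λ i → w i · p i) j ≈ ∑ (λ i → w i ⊗ p i j)
combination≈ w p j = ≈-trans (sum≈∑ (λ i → w i * p i j)) (∑-cong λ i → *≈⊗ (w i) (p i j))

-- Finding a positive weight constructively.

halve : ∀ {ε} → 0ℚ ℚ.< ε → ∃[ δ ] 0ℚ ℚ.< δ × δ ℚ.+ δ ≡ ε
halve {ε} 0<ε = ½ ℚ.* ε , half-pos 0<ε , halves ε

rest≥ : ∀ {x y p q ε} → p ℚ.+ q ≡ ε → fromℚ ε ≤ x ⊕ y → x ≤ fromℚ p → fromℚ q ≤ y
rest≥ {x} {y} {p} {q} ≡.refl ε≤x⊕y x≤p = +-cancelʳ-≤ (fromℚ p) (begin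
  fromℚ q ⊕ fromℚ p    ≈⟨ ℝ-ring.+-comm (fromℚ q) (fromℚ p) ⟩
  fromℚ p ⊕ fromℚ q    ≈⟨ fromℚ-+ p q ⟨
  fromℚ (p ℚ.+ q)      ≤⟨ ε≤x⊕y ⟩
  x ⊕ y                ≈⟨ ℝ-ring.+-comm x y ⟩
  y ⊕ x                ≤⟨ ⊕-mono-≤ (≈⇒≤ (≈-refl {y})) x≤p ⟩
  y ⊕ fromℚ p          ∎)

-- With ε = 2δ and δ = 2γ, the first term is either at least γ, which ends the search, or at most δ,
-- which leaves at least δ for the rest. An empty sum cannot reach a positive bound, so the search
-- succeeds.
positive-term : ∀ {n} (w : Vector ℝ n) {ε} → 0ℚ ℚ.< ε → fromℚ ε ≤ ∑ w →
                ∃[ i ] ∃[ q ] 0ℚ ℚ.< q × fromℚ q ≤ w i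
positive-term {0} w {ε} 0<ε ε≤0 with x<y+ε ε≤0 ε 0<ε
... | N , h = contradiction (subst (ε ℚ.<_) (ℚₚ.+-identityˡ ε) (h N ℕₚ.≤-refl)) (ℚₚ.<-irrefl ≡.refl)
positive-term {ℕ.suc n} w 0<ε ε≤∑ = split (halve 0<ε)
  where
  split : (∃[ δ ] 0ℚ ℚ.< δ × δ ℚ.+ δ ≡ _) → ∃[ i ] ∃[ q ] 0ℚ ℚ.< q × fromℚ q ≤ w i
  split (δ , 0<δ , δ+δ≡ε) = search (halve 0<δ)
    where
    search : (∃[ γ ] 0ℚ ℚ.< γ × γ ℚ.+ γ ≡ δ) → ∃[ i ] ∃[ q ] 0ℚ ℚ.< q × fromℚ q ≤ w i
    search (γ , 0<γ , γ+γ≡δ) with ≤-dichotomy (w zero) (subst (γ ℚ.<_) γ+γ≡δ (q<q+ε γ 0<γ))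
    ... | inj₁ γ≤w₀ = zero , γ , 0<γ , γ≤w₀
    ... | inj₂ w₀≤δ = let i , q , 0<q , q≤wᵢ = positive-term (w ∘ suc) 0<δ (rest≥ δ+δ≡ε ε≤∑ w₀≤δ) in
                      suc i , q , 0<q , q≤wᵢ

fromℚ-nonNeg : ∀ {q} → 0ℚ ℚ.≤ q → 0ℝ ≤ fromℚ q
fromℚ-nonNeg 0≤q = ≤-pointwise λ _ → 0≤q

reciprocal : ∀ {q} → 0ℚ ℚ.< q → ∃[ r ] 0ℝ ≤ r × r ⊗ fromℚ q ≈ 1ℝ
reciprocal {q} 0<q = from-divide (divide 0<q (ℚₚ.positive⁻¹ 1ℚ))
  where
  from-divide : (∃[ r ] 0ℚ ℚ.< r × q ℚ.* r ≡ 1ℚ) → ∃[ r ] 0ℝ ≤ r × r ⊗ fromℚ q ≈ 1ℝ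
  from-divide (r , 0<r , qr≡1) = fromℚ r , fromℚ-nonNeg (ℚₚ.<⇒≤ 0<r) ,
    ≈-trans (≈-sym (fromℚ-* r q)) (fromℚ-cong (≡.trans (ℚₚ.*-comm r q) qr≡1))

positive-weight : ∀ {n} {w : Vector ℝ n} → ∑ w ≈ 1ℝ →
                  ∃[ i ] ∃[ q ] ∃[ r ] q ≤ w i × 0ℝ ≤ r × r ⊗ q ≈ 1ℝ
positive-weight {w = w} ∑w≈1 =
  let i , q , 0<q , q≤wᵢ = positive-term w (ℚₚ.positive⁻¹ 1ℚ) (≈⇒≥ ∑w≈1)
      r , 0≤r , rq≈1     = reciprocal 0<q
  in i , fromℚ q , r , q≤wᵢ , 0≤r , rq≈1

-- Numerical identities for the convex combinations.

-- Coefficients of sgn s · eᵢ as a convex combination of eᵢ and − eᵢ.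
weight : Fin 3 → Fin 2 → ℚ
weight 0F _  = ½
weight 1F 0F = 1ℚ
weight 1F 1F = 0ℚ
weight 2F 0F = 0ℚ
weight 2F 1F = 1ℚ

weight-nonNeg : ∀ s k → 0ℚ ℚ.≤ weight s k
weight-nonNeg 0F _  = ℚₚ.nonNegative⁻¹ ½
weight-nonNeg 1F 0F = ℚₚ.nonNegative⁻¹ 1ℚ
weight-nonNeg 1F 1F = ℚₚ.≤-refl
weight-nonNeg 2F 0F = ℚₚ.≤-refl
weight-nonNeg 2F 1F = ℚₚ.nonNegative⁻¹ 1ℚ

weight-sum : ∀ s → weight s 0F ℚ.+ weight s 1F ≡ 1ℚ
weight-sum 0F = ≡.refl
weight-sum 1F = ≡.refl
weight-sum 2F = ≡.refl

weight-combination : ∀ s u →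
  (sgn s ℤ.* u) ℚ./ 1 ≡ weight s 0F ℚ.* ((sgn 1F ℤ.* u) ℚ./ 1) ℚ.+ weight s 1F ℚ.* ((sgn 2F ℤ.* u) ℚ./ 1)
weight-combination s u rewrite /1-homo-* (sgn s) u | /1-homo-* (sgn 1F) u | /1-homo-* (sgn 2F) u = identity s (u ℚ./ 1)
  where
  identity : ∀ s q → (sgn s ℚ./ 1) ℚ.* q ≡
    weight s 0F ℚ.* ((sgn 1F ℚ./ 1) ℚ.* q) ℚ.+ weight s 1F ℚ.* ((sgn 2F ℚ./ 1) ℚ.* q)
  identity 0F = solve 1 (λ q → con 0ℚ :* q := con ½ :* (con 1ℚ :* q) :+ con ½ :* (con (ℚ.- 1ℚ) :* q)) ≡.refl
  identity 1F = solve 1 (λ q → con 1ℚ :* q := con 1ℚ :* (con 1ℚ :* q) :+ con 0ℚ :* (con (ℚ.- 1ℚ) :* q)) ≡.refl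
  identity 2F = solve 1 (λ q → con (ℚ.- 1ℚ) :* q := con 0ℚ :* (con 1ℚ :* q) :+ con 1ℚ :* (con (ℚ.- 1ℚ) :* q)) ≡.refl

fromℚ-combination : ∀ a b p q {r} → r ≡ a ℚ.* p ℚ.+ b ℚ.* q →
                    fromℚ r ≈ fromℚ a ⊗ fromℚ p ⊕ fromℚ b ⊗ fromℚ q
fromℚ-combination a b p q ≡.refl = ≈-trans (fromℚ-+ (a ℚ.* p) (b ℚ.* q))
  (ℝ-ring.+-cong (fromℚ-* a p) (fromℚ-* b q))

fromℚ-+≈1 : ∀ a b → a ℚ.+ b ≡ 1ℚ → fromℚ a ⊕ fromℚ b ≈ 1ℝ
fromℚ-+≈1 a b a+b≡1 = ≈-trans (≈-sym (fromℚ-+ a b)) (fromℚ-cong a+b≡1)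

fromℕ-cancel-≤ : ∀ a b → fromℤ (+ a) ≤ fromℤ (+ b) → a ℕ.≤ b
fromℕ-cancel-≤ a b a≤b = ℤₚ.drop‿+≤+ (fromℤ-cancel-≤ {+ a} {+ b} a≤b)

reciprocal-suc : ∀ n → ∃[ r ] 0ℝ ≤ r × r ⊗ fromℤ (+ ℕ.suc n) ≈ 1ℝ
reciprocal-suc n = reciprocal (ℚₚ.positive⁻¹ (+ ℕ.suc n ℚ./ 1) {{ℚₚ.normalize-pos (ℕ.suc n) 1}})

rescale : ∀ c r x → r ⊗ c ≈ 1ℝ → x ≈ c * (r ⊗ x)
rescale c r x rc≈1 = begin-equality
  x              ≈⟨ ℝ-ring.*-identityˡ x ⟨
  1ℝ ⊗ x         ≈⟨ ℝ-ring.*-congʳ rc≈1 ⟨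
  (r ⊗ c) ⊗ x    ≈⟨ ℝ-ring.*-congʳ (ℝ-ring.*-comm r c) ⟩
  (c ⊗ r) ⊗ x    ≈⟨ ℝ-ring.*-assoc c r x ⟩
  c ⊗ (r ⊗ x)    ≈⟨ *≈⊗ c (r ⊗ x) ⟨
  c * (r ⊗ x)    ∎

1≢k+k : ∀ k → 1ℤ ≢ k ℤ.+ k
-- For positive `k` the double has a second successor, which `+-suc` exposes; for other `k` the
-- constructors already clash.
1≢k+k (+ ℕ.suc n) eq with ≡.trans eq (cong (λ n → + ℕ.suc n) (ℕₚ.+-suc n n))
... | ()

-- The ellipsoid, its convex hull and the vertices of a hull of lattice points.

module _ {m : ℕ} where
  -- A definition of its own: two occurrences of form, a copy made by a module application,
  -- need not be syntactically equal, and E would then be compared by unfolding.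
  axes : Vector (LinearForm (ℕ.suc m)) (ℕ.suc m)
  axes = form

  E : Subset (ℕ.suc m)
  E x = sum (λ i → (axes i ⟨ x ⟩ - 0ℝ) * (axes i ⟨ x ⟩ - 0ℝ)) ≈ 1ℝ

  sum-squares≈norm : ∀ x → sum (λ i → (axes i ⟨ x ⟩ - 0ℝ) * (axes i ⟨ x ⟩ - 0ℝ)) ≈ norm {m} x
  sum-squares≈norm x = ≈-trans (sum≈∑ (λ i → (axes i ⟨ x ⟩ - 0ℝ) * (axes i ⟨ x ⟩ - 0ℝ))) (∑-cong λ i →
    ≈-trans ([x-0]²≈x⊗x (axes i ⟨ x ⟩)) (ℝ-ring.*-cong (⟨⟩≈∙ (axes i) x) (⟨⟩≈∙ (axes i) x)))

  E-isEllipsoid : IsEllipsoid E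
  E-isEllipsoid = axes , (λ _ → 0ℝ) ,
    (λ c dep → form-independent c λ j → ≈-trans (≈-sym (combination≈ c axes j)) (dep j)) ,
    id , id

  norm-cong : {x y : ℝ^ (ℕ.suc m)} → x ≋ y → norm x ≈ norm y
  norm-cong x≋y = ∑-cong λ i → ℝ-ring.*-cong
    (∙-cong {u = form i} (λ _ → ≈-refl) x≋y) (∙-cong {u = form i} (λ _ → ≈-refl) x≋y)

  conv-intro : ∀ {S : Subset (ℕ.suc m)} {n} (p : Vector (ℝ^ (ℕ.suc m)) n) (w : Vector ℝ n) {x} → (∀ i → p i ∈ S) →
               (∀ i → 0ℝ ≤ w i) → ∑ w ≈ 1ℝ → (∀ j → x j ≈ ∑ (λ i → w i ⊗ p i j)) → x ∈ conv S
  conv-intro p w p∈S 0≤w ∑w≈1 x≈ = _ , p , w , p∈S , 0≤w , ≈-trans (sum≈∑ w) ∑w≈1 ,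
    λ j → ≈-trans (x≈ j) (≈-sym (combination≈ w p j))

  ⊆conv : {S : Subset (ℕ.suc m)} → ∀ {x} → x ∈ S → x ∈ conv S
  ⊆conv {x = x} x∈S = conv-intro (λ (_ : Fin 1) → x) (λ _ → 1ℝ) (λ _ → x∈S)
    (λ _ → fromℚ-nonNeg (ℚₚ.nonNegative⁻¹ 1ℚ)) (ℝ-ring.+-identityʳ 1ℝ)
    λ j → ≈-sym (≈-trans (ℝ-ring.+-identityʳ (1ℝ ⊗ x j)) (ℝ-ring.*-identityˡ (x j)))

  conv-mono : {S T : Subset (ℕ.suc m)} → (∀ {x} → x ∈ S → x ∈ T) → ∀ {x} → x ∈ conv S → x ∈ conv T
  conv-mono S⊆T (n , p , w , p∈S , rest) = n , p , w , (λ i → S⊆T (p∈S i)) , rest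

  -- Applied twice: to `E` for the solid ellipsoid, then to the lattice points in it for the hull.
  conv-norm≤1 : {S : Subset (ℕ.suc m)} → (∀ {x} → x ∈ S → norm x ≤ 1ℝ) → ∀ {x} → x ∈ conv S → norm x ≤ 1ℝ
  conv-norm≤1 S≤1 {x} (n , p , w , p∈S , 0≤w , ∑w≈1 , x≋) =
    unitBall-convex {w = w} {q = λ i j → form j ∙ p i} {y = λ j → form j ∙ x} 0≤w
      (≈-trans (≈-sym (sum≈∑ w)) ∑w≈1)
      (λ j → ∙-combination (form j) w p λ k → ≈-trans (x≋ k) (combination≈ w p k))
      (λ i → S≤1 (p∈S i))

  convE-norm≤1 : ∀ {x} → x ∈ conv E → norm x ≤ 1ℝ
  convE-norm≤1 = conv-norm≤1 λ {x} x∈E → ≈⇒≤ (≈-trans (≈-sym (sum-squares≈norm x)) x∈E)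

  hull-norm≤1 : ∀ {x} → x ∈ latticeHull E → norm x ≤ 1ℝ
  hull-norm≤1 = conv-norm≤1 {conv E ∩ Lattice} λ x∈ → convE-norm≤1 (proj₁ x∈)

  -- The supporting functional attains its maximum `b` at the vertex, an average of points of `S`,
  -- hence also at any of these points whose weight is bounded away from zero. Uniqueness of the
  -- maximiser identifies that point with the vertex.
  vertex-lattice : {S : Subset (ℕ.suc m)} → (∀ {x} → x ∈ S → x ∈ Lattice) →
                   ∀ x → x ∈ IsVertex (conv S) → x ∈ Lattice
  vertex-lattice {S} S⊆L x ((n , p , w , p∈S , 0≤w , ∑w≈1 , x≋) , u , b , u≤b , ux≈b , unique) =
    lattice (positive-weight (≈-trans (≈-sym (sum≈∑ w)) ∑w≈1))
    where
    attained : ∀ i {q r} → q ≤ w i → 0ℝ ≤ r → r ⊗ q ≈ 1ℝ → u ⟨ p i ⟩ ≈ b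
    attained i q≤wᵢ 0≤r rq≈1 = ≈-trans (⟨⟩≈∙ u (p i)) (average-attained {w = w} {f = λ k → u ∙ p k} 0≤w
      (≈-trans (≈-sym (sum≈∑ w)) ∑w≈1)
      (λ k → ≤-trans (≈⇒≥ (⟨⟩≈∙ u (p k))) (u≤b (p k) (⊆conv {S} (p∈S k))))
      (≈-trans (≈-sym (∙-combination u w p λ j → ≈-trans (x≋ j) (combination≈ w p j)))
        (≈-trans (≈-sym (⟨⟩≈∙ u x)) ux≈b))
      i q≤wᵢ 0≤r rq≈1)
    lattice : (∃[ i ] ∃[ q ] ∃[ r ] q ≤ w i × 0ℝ ≤ r × r ⊗ q ≈ 1ℝ) → x ∈ Lattice
    lattice (i , q , r , q≤wᵢ , 0≤r , rq≈1) =
      let pᵢ≋x : p i ≋ x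
          pᵢ≋x = unique (p i) (⊆conv {S} (p∈S i)) (attained i q≤wᵢ 0≤r rq≈1)
          z , pᵢ≋z = S⊆L (p∈S i)
      in z , λ j → ≈-trans (≈-sym (pᵢ≋x j)) (pᵢ≋z j)

  -- The lattice points of the solid ellipsoid and the resulting polytope.

  vtx : Fin 3 → Fin (ℕ.suc m) → ℝ^ (ℕ.suc m)
  vtx s i j = fromℤ (sgn s ℤ.* unit i j)

  vtx∈E : ∀ s i → ℤ.∣ sgn s ∣ ℕ.* ℤ.∣ sgn s ∣ ≡ 1 → vtx s i ∈ E
  vtx∈E s i eq = ≈-trans (sum-squares≈norm (vtx s i)) (≈-trans
    (norm-even (λ j → sgn s ℤ.* unit i j) (λ j → sgn s ℤ.* δℤ i j) (double-unit (sgn s) i))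
    (≈-trans (fromℤ-cong (cong +_ (≡.trans (squareSum-δ (sgn s) i) eq))) 1#-homo))

  segment⊆conv : ∀ {S : Subset (ℕ.suc m)} {p q x : ℝ^ (ℕ.suc m)} {a b : ℝ} → p ∈ S → q ∈ S → 0ℝ ≤ a → 0ℝ ≤ b →
                 a ⊕ b ≈ 1ℝ → (∀ j → x j ≈ a ⊗ p j ⊕ b ⊗ q j) → x ∈ conv S
  segment⊆conv {S} {p} {q} {x} {a} {b} p∈S q∈S 0≤a 0≤b a+b≈1 x≈ = conv-intro pt w
    (λ { 0F → p∈S ; 1F → q∈S })
    (λ { 0F → 0≤a ; 1F → 0≤b })
    (≈-trans (ℝ-ring.+-congˡ (ℝ-ring.+-identityʳ b)) a+b≈1)
    λ j → ≈-trans (x≈ j) (ℝ-ring.+-congˡ (≈-sym (ℝ-ring.+-identityʳ (b ⊗ q j))))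
    where
    pt : Fin 2 → ℝ^ (ℕ.suc m)
    pt 0F = p
    pt 1F = q
    w : Fin 2 → ℝ
    w 0F = a
    w 1F = b

  -- The origin is not on `E`, so all three signs are treated alike, as points of the segment
  -- joining eᵢ to -eᵢ.
  vtx∈convE : ∀ s i {x} → x ≋ vtx s i → x ∈ conv E
  vtx∈convE s i {x} x≋ = segment⊆conv {E} {vtx 1F i} {vtx 2F i} {x} {fromℚ (weight s 0F)} {fromℚ (weight s 1F)}
    (vtx∈E 1F i ≡.refl) (vtx∈E 2F i ≡.refl)
    (fromℚ-nonNeg (weight-nonNeg s 0F)) (fromℚ-nonNeg (weight-nonNeg s 1F))
    (fromℚ-+≈1 (weight s 0F) (weight s 1F) (weight-sum s))
    λ j → ≈-trans (x≋ j) (fromℚ-combination (weight s 0F) (weight s 1F)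
      ((sgn 1F ℤ.* unit i j) ℚ./ 1) ((sgn 2F ℤ.* unit i j) ℚ./ 1) (weight-combination s (unit i j)))

  vtx∈S : ∀ s i {x} → x ≋ vtx s i → x ∈ conv E ∩ Lattice
  vtx∈S s i x≋ = vtx∈convE s i x≋ , (λ j → sgn s ℤ.* unit i j) , x≋

  -- In the odd case the doubled coordinates have square sum at least d ≥ 5, whereas four times the
  -- squared length is at most 4.
  ball-even : 5 ℕ.≤ ℕ.suc m → (z : Vector ℤ (ℕ.suc m)) → norm (fromℤ ∘ z) ≤ 1ℝ → ∃[ k ] (∀ i → double z i ≡ k i ℤ.+ k i)
  ball-even 5≤d z N≤1 with parity z
  ... | even k z≡ = k , z≡
  ... | odd k z≡  = contradiction
    (ℕₚ.≤-trans 5≤d (ℕₚ.≤-trans (squareSum-odd {k = k} z≡)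
      (fromℕ-cancel-≤ (squareSum (double z)) 4 4N≤4)))
    (ℕₚ.<-irrefl ≡.refl)
    where
    N = norm (fromℤ ∘ z)
    4N≤4 : fromℤ (+ squareSum (double z)) ≤ fromℤ (+ 4)
    4N≤4 = begin
      fromℤ (+ squareSum (double z))    ≈⟨ 4norm z ⟨
      (N ⊕ N) ⊕ (N ⊕ N)                 ≤⟨ ⊕-mono-≤ (⊕-mono-≤ N≤1 N≤1) (⊕-mono-≤ N≤1 N≤1) ⟩
      (1ℝ ⊕ 1ℝ) ⊕ (1ℝ ⊕ 1ℝ)             ≈⟨ ℝ-ring.+-cong (fromℚ-+ 1ℚ 1ℚ) (fromℚ-+ 1ℚ 1ℚ) ⟨
      fromℤ (+ 2) ⊕ fromℤ (+ 2)         ≈⟨ fromℤ-+ (+ 2) (+ 2) ⟨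
      fromℤ (+ 4)                       ∎

  lattice-even : 5 ℕ.≤ ℕ.suc m → ∀ {x : ℝ^ (ℕ.suc m)} → norm x ≤ 1ℝ → ((z , _) : x ∈ Lattice) →
                 ∃[ k ] (∀ i → double z i ≡ k i ℤ.+ k i)
  lattice-even 5≤d N≤1 (z , x≋z) = ball-even 5≤d z (≤-trans (≈⇒≥ (norm-cong x≋z)) N≤1)

  ball-lattice : 5 ℕ.≤ ℕ.suc m → ∀ {x} → norm x ≤ 1ℝ → x ∈ Lattice → ∃[ s ] ∃[ i ] x ≋ vtx s i
  ball-lattice 5≤d {x} N≤1 (z , x≋z) =
    let k , z≡ = lattice-even 5≤d N≤1 (z , x≋z) in
    from-unit k z≡ (squareSum≤1 {m = k} (fromℕ-cancel-≤ (squareSum k) 1 (short k z≡)))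
    where
    short : ∀ k → (∀ i → double z i ≡ k i ℤ.+ k i) → fromℤ (+ squareSum k) ≤ fromℤ 1ℤ
    short k z≡ = begin
      fromℤ (+ squareSum k)    ≈⟨ norm-even z k z≡ ⟨
      norm (fromℤ ∘ z)         ≈⟨ norm-cong x≋z ⟨
      norm x                   ≤⟨ N≤1 ⟩
      1ℝ                       ≈⟨ 1#-homo ⟨
      fromℤ 1ℤ                 ∎
    locate : ∀ k → (∀ i → double z i ≡ k i ℤ.+ k i) → ∀ s i → (∀ j → k j ≡ sgn s ℤ.* δℤ i j) → x ≋ vtx s i
    locate k z≡ s i k≡ j = ≈-trans (x≋z j) (fromℤ-cong {z j} {sgn s ℤ.* unit i j}
      (double-injective {y = z} {λ l → sgn s ℤ.* unit i l} (λ l → ≡.trans (z≡ l)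
        (≡.trans (cong₂ ℤ._+_ (k≡ l) (k≡ l)) (≡.sym (double-unit (sgn s) i l)))) j))
    from-unit : ∀ k → (∀ i → double z i ≡ k i ℤ.+ k i) →
                (∀ j → k j ≡ 0ℤ) ⊎ (∃[ s ] ∃[ i ] ∀ j → k j ≡ sgn s ℤ.* δℤ i j) → ∃[ s ] ∃[ i ] x ≋ vtx s i
    -- With sign 0 every index represents the origin; `zero` is an arbitrary choice.
    from-unit k z≡ (inj₁ k≡0)          = 0F , zero , locate k z≡ 0F zero k≡0
    from-unit k z≡ (inj₂ (s , i , k≡)) = s , i , locate k z≡ s i k≡

  hull-isLatticePolytope : 5 ℕ.≤ ℕ.suc m → IsLatticePolytope (latticeHull E)
  hull-isLatticePolytope 5≤d =
    -- The pairs of a sign and an index are flattened into one list. The origin occurs once for each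
    -- index, which is allowed because the generators of a polytope may repeat.
    (3 ℕ.* ℕ.suc m , v ,
      conv-mono {S = conv E ∩ Lattice} (λ {x} → S⊆V {x}) ,
      conv-mono {T = conv E ∩ Lattice} (λ {x} → V⊆S {x})) ,
    vertex-lattice {S = conv E ∩ Lattice} proj₂
    where
    v : Fin (3 ℕ.* ℕ.suc m) → ℝ^ (ℕ.suc m)
    v κ = uncurry vtx (remQuot (ℕ.suc m) κ)
    S⊆V : ∀ {x} → x ∈ conv E ∩ Lattice → ∃[ κ ] x ≋ v κ
    S⊆V {x} (x∈convE , x∈L) =
      let s , i , x≋ = ball-lattice 5≤d (convE-norm≤1 x∈convE) x∈L in
      combine s i , subst (λ (s , i) → x ≋ vtx s i) (≡.sym (remQuot-combine s i)) x≋
    V⊆S : ∀ {x} → ∃[ κ ] x ≋ v κ → x ∈ conv E ∩ Lattice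
    V⊆S (κ , x≋) = vtx∈S (proj₁ (remQuot (ℕ.suc m) κ)) (proj₂ (remQuot {3} (ℕ.suc m) κ)) x≋

  -- Failure of normality in the d-th dilate.

  scaled-deep∈hull : ∀ {r} → 0ℝ ≤ r → r ⊗ fromℤ (+ ℕ.suc m) ≈ 1ℝ → (λ j → r ⊗ fromℤ (deep j)) ∈ latticeHull E
  scaled-deep∈hull {r} 0≤r rd≈1 = conv-intro {S = conv E ∩ Lattice} pt w {λ j → r ⊗ fromℤ (deep j)} pt∈S 0≤w ∑w≈1 r·deep≈
    where
    pt : Fin (ℕ.suc (ℕ.suc m)) → ℝ^ (ℕ.suc m)
    pt zero    = vtx 0F zero
    pt (suc i) = vtx 1F i
    w : Fin (ℕ.suc (ℕ.suc m)) → ℝ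
    -- Here `r` is 1/d. The eᵢ carry weight 1/(2d) each, ½ in total, and the origin takes the other
    -- half.
    w zero    = fromℚ ½
    w (suc i) = fromℚ ½ ⊗ r
    pt∈S : ∀ k → pt k ∈ conv E ∩ Lattice
    pt∈S zero    = vtx∈S 0F zero λ _ → ≈-refl
    pt∈S (suc i) = vtx∈S 1F i λ _ → ≈-refl
    0≤½ : 0ℝ ≤ fromℚ ½
    0≤½ = fromℚ-nonNeg (ℚₚ.nonNegative⁻¹ ½)
    0≤w : ∀ k → 0ℝ ≤ w k
    0≤w zero    = 0≤½
    0≤w (suc i) = ⊗-nonNeg 0≤½ 0≤r
    ∑w≈1 : ∑ w ≈ 1ℝ
    ∑w≈1 = begin-equality
      fromℚ ½ ⊕ ∑ {ℕ.suc m} (λ _ → fromℚ ½ ⊗ r)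
        ≈⟨ ℝ-ring.+-congˡ (sum-const (ℕ.suc m) (fromℚ ½ ⊗ r)) ⟩
      fromℚ ½ ⊕ fromℤ (+ ℕ.suc m) ⊗ (fromℚ ½ ⊗ r)
        ≈⟨ ℝ-ring.+-congˡ (x∙[y*z]≈y∙[x*z] (fromℤ (+ ℕ.suc m)) (fromℚ ½) r) ⟩
      fromℚ ½ ⊕ fromℚ ½ ⊗ (fromℤ (+ ℕ.suc m) ⊗ r)
        ≈⟨ ℝ-ring.+-congˡ (ℝ-ring.*-congˡ (≈-trans (ℝ-ring.*-comm (fromℤ (+ ℕ.suc m)) r) rd≈1)) ⟩
      fromℚ ½ ⊕ fromℚ ½ ⊗ 1ℝ
        ≈⟨ ℝ-ring.+-congˡ (ℝ-ring.*-identityʳ (fromℚ ½)) ⟩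
      fromℚ ½ ⊕ fromℚ ½
        ≈⟨ ½+½≈1 ⟩
      1ℝ ∎
    r·deep≈ : ∀ j → r ⊗ fromℤ (deep j) ≈ ∑ (λ k → w k ⊗ pt k j)
    r·deep≈ j = begin-equality
      r ⊗ fromℤ (deep j)
        ≈⟨ sum-units r j ⟨
      ∑ {ℕ.suc m} (λ i → (fromℚ ½ ⊗ r) ⊗ vtx 1F i j)
        ≈⟨ ℝ-ring.+-identityˡ (∑ {ℕ.suc m} (λ i → (fromℚ ½ ⊗ r) ⊗ vtx 1F i j)) ⟨
      0ℝ ⊕ ∑ {ℕ.suc m} (λ i → (fromℚ ½ ⊗ r) ⊗ vtx 1F i j)
        ≈⟨ ℝ-ring.+-congʳ (ℝ-ring.zeroʳ (fromℚ ½)) ⟨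
      fromℚ ½ ⊗ 0ℝ ⊕ ∑ {ℕ.suc m} (λ i → (fromℚ ½ ⊗ r) ⊗ vtx 1F i j)
        ≈⟨ ℝ-ring.+-congʳ (ℝ-ring.*-congˡ {fromℚ ½} (fromℤ-cong {sgn 0F ℤ.* unit zero j} {0ℤ} (ℤₚ.*-zeroˡ (unit zero j)))) ⟨
      fromℚ ½ ⊗ vtx 0F zero j ⊕ ∑ {ℕ.suc m} (λ i → (fromℚ ½ ⊗ r) ⊗ vtx 1F i j) ∎

  deep∈dilate : dilate (ℕ.suc m) (latticeHull E) (map fromℤ deep)
  deep∈dilate =
    let r , 0≤r , rd≈1 = reciprocal-suc m in
    (λ j → r ⊗ fromℤ (deep j)) , scaled-deep∈hull 0≤r rd≈1 , λ j → rescale (fromℤ (+ ℕ.suc m)) r (fromℤ (deep j)) rd≈1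

  -- Every summand lies in the unit ball, hence in ℤᵈ, so its first lattice coordinate, twice an
  -- integer Euclidean coordinate, is even. The sum would then be even there, but `deep` has 1.
  hull-notNormal : 5 ℕ.≤ ℕ.suc m → ¬ IsNormal (latticeHull E)
  hull-notNormal 5≤d (_ , normal) = odd-sum (normal (ℕ.suc m) (map fromℤ deep) deep∈dilate (deep , λ _ → ≈-refl))
    where
    odd-sum : ¬ (∃ λ (xs : Vector (ℝ^ (ℕ.suc m)) (ℕ.suc m)) →
      (∀ i → xs i ∈ latticeHull E × xs i ∈ Lattice) × sumᵛ xs ≋ map fromℤ deep)
    odd-sum (xs , xs∈ , ∑xs≋) =
      let k , ∑≈ = sum-even {f = λ i → xs i zero} λ i → first-even (xs i) (hull-norm≤1 (proj₁ (xs∈ i))) (proj₂ (xs∈ i))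
      in 1≢k+k k (fromℤ-injective {deep {m} zero} {k ℤ.+ k} (≈-trans (≈-sym (∑xs≋ zero)) (≈-trans (sum≈∑ (λ i → xs i zero)) ∑≈)))
      where
      first-even : ∀ (x : ℝ^ (ℕ.suc m)) → norm x ≤ 1ℝ → x ∈ Lattice → ∃[ k ] x zero ≈ fromℤ (k ℤ.+ k)
      first-even x N≤1 (z , x≋z) =
        let k , z≡ = lattice-even 5≤d {x} N≤1 (z , x≋z)
        in k zero , ≈-trans (x≋z zero) (fromℤ-cong {z zero} {k zero ℤ.+ k zero} (z≡ zero))

mainTheorem2 : (d : ℕ) → d ≥ 5 →
    ∃[ E ] (IsEllipsoid {d} E × IsLatticePolytope (latticeHull E) × ¬ IsNormal (latticeHull E))
mainTheorem2 (ℕ.suc m) d≥5 = E {m} , E-isEllipsoid {m} , hull-isLatticePolytope {m} d≥5 , hull-notNormal {m} d≥5
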